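{- Let $\mathbb{K}$ be a field of characteristic zero and $n$ a positive integer. (i) For every $d\ge 0$, the homogeneous component $\mathcal{I}_{n,d}$ of degree $d$ of $\mathcal{I}_n$ has as a $\mathbb{K}$-vector space basis the set of all invariants $\mathcal{O}(\mathbf c_1)\cdots\mathcal{O}(\mathbf c_k)$, where each $\mathbf c_i$ is a quasi-connected multigraph on $n$ vertices with $n_i$ non-isolated vertices and $d_i$ edges, and where $n_1+\dots+n_k\le n$ and $d_1+\dots+d_k=d$. (ii) The invariant ring $\mathcal{I}_n$ is generated as a $\mathbb{K}$-algebra by the set of all homogeneous invariants $\mathcal{O}(\mathbf g)$, where $\mathbf g$ is a quasi-connected multigraph on $n$ vertices with at most $\beta(\mathcal{I}_n)$ edges.
   Context: Let $\mathbb{K}[x_{\{i,j\}}]$ be the polynomial ring in $\binom n2$ variables indexed by the pairs $\{i,j\}$, $1\le i<j\le n$. The symmetric group $\mathfrak{S}_n$ acts on it by $\sigma\cdot x_{\{i,j\}}=x_{\{\sigma(i),\sigma(j)\}}$, and $\mathcal{I}_n:=\mathbb{K}[x_{\{i,j\}}]^{\mathfrak{S}_n}$, graded by polynomial degree. A multigraph $\mathbf g$ on $\{1,\dots,n\}$ (undirected, no loops) is a family $(g_{\{i,j\}})$ of non-negative integers (edge multiplicities); its number of edges is $\sum g_{\{i,j\}}$ (counted with multiplicity). A vertex is isolated if all pairs containing it have multiplicity $0$. A multigraph is quasi-connected if it has at most one non-trivial connected component, i.e. at most one connected component not reduced to a single vertex. Write $x^{\mathbf g}:=\prod x_{\{i,j\}}^{g_{\{i,j\}}}$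 and $\mathcal{O}(\mathbf g):=\sum_{\mathbf h}x^{\mathbf h}$, the sum being over all distinct multigraphs $\mathbf h$ in the $\mathfrak{S}_n$-orbit of $\mathbf g$; it depends only on the isomorphism class of $\mathbf g$. $\beta(\mathcal{I}_n)$ denotes the smallest integer $d$ such that $\mathcal{I}_n$ is generated as a $\mathbb{K}$-algebra by its invariants of degree at most $d$. -}

module Defs where

open import Algebra.Apartness.Bundles using (HeytingField; HeytingCommutativeRing)
open import Algebra.Bundles using (CommutativeRing)
import Algebra.Properties.Semiring.Mult as Mult
open import Data.Bool.Base using (if_then_else_)
open import Data.Fin.Base using (Fin; zero)
open import Data.Fin.Permutation using (Permutation′; insert; _⟨$⟩ˡ_) renaming (id to idₚ)
open import Data.Fin.Properties using (all?; _<?_)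
open import Data.List.Base
  using (List; []; _∷_; _++_; map; length; filter; foldr; concatMap;
         cartesianProductWith; deduplicate; allFin)
open import Data.List.Relation.Unary.All using (All)
open import Data.Nat.Base using (ℕ; zero; suc; _+_; _≤_; _<_)
open import Data.Nat.ListAction using () renaming (sum to total)
open import Data.Nat.Properties using (_≟_; +-0-commutativeMonoid)
open import Algebra.Properties.CommutativeMonoid.Sum +-0-commutativeMonoid using (sum)
import Data.Vec.Functional as Vector
open import Data.Product.Base using (Σ-syntax; ∃-syntax; _×_; _,_; map₂)
open import Function.Base using (_∘_)
open import Level using (Level; _⊔_)
open import Relation.Binary.Construct.Closure.ReflexiveTransitive using (Star)
open import Relation.Binary.PropositionalEquality
  using (_≡_; _≢_; refl; cong₂)
open import Relation.Nullary.Decidable using (Dec; does; ¬?)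
open import Relation.Unary using (Pred; _⊆_; _≐_)

------------------------------------------------------------------------
-- Multigraphs

-- A family indexed by the unordered pairs {i,j}, i ≠ j, given as a
-- symmetric matrix with zero diagonal.
record Multigraph (n : ℕ) : Set where
  field
    mult        : Fin n → Fin n → ℕ
    mult-sym    : ∀ i j → mult i j ≡ mult j i
    mult-irrefl : ∀ i → mult i i ≡ 0

open Multigraph public

module _ {n : ℕ} where

  infix 4 _≈ᵍ_ _≟ᵍ_

  _≈ᵍ_ : Multigraph n → Multigraph n → Set
  g ≈ᵍ h = ∀ i j → mult g i j ≡ mult h i j

  _≟ᵍ_ : (g h : Multigraph n) → Dec (g ≈ᵍ h)
  g ≟ᵍ h = all? λ i → all? λ j → mult g i j ≟ mult h i j

  ∅ᵍ : Multigraph n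
  ∅ᵍ .mult i j = 0
  ∅ᵍ .mult-sym i j = refl
  ∅ᵍ .mult-irrefl i = refl

  infixl 6 _+ᵍ_

  _+ᵍ_ : Multigraph n → Multigraph n → Multigraph n
  (g +ᵍ h) .mult i j = mult g i j + mult h i j
  (g +ᵍ h) .mult-sym i j = cong₂ _+_ (mult-sym g i j) (mult-sym h i j)
  (g +ᵍ h) .mult-irrefl i = cong₂ _+_ (mult-irrefl g i) (mult-irrefl h i)

  -- The pair {σ i , σ j} has in σ • g the multiplicity of {i , j} in g.
  infixr 7 _•_

  _•_ : Permutation′ n → Multigraph n → Multigraph n
  (σ • g) .mult i j = mult g (σ ⟨$⟩ˡ i) (σ ⟨$⟩ˡ j)
  (σ • g) .mult-sym i j = mult-sym g (σ ⟨$⟩ˡ i) (σ ⟨$⟩ˡ j)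
  (σ • g) .mult-irrefl i = mult-irrefl g (σ ⟨$⟩ˡ i)

  edges : Multigraph n → ℕ
  edges g = sum λ i → sum λ j → if does (i <? j) then mult g i j else 0

  Isolated : Multigraph n → Fin n → Set
  Isolated g i = ∀ j → mult g i j ≡ 0

  isolated? : ∀ g i → Dec (Isolated g i)
  isolated? g i = all? λ j → mult g i j ≟ 0

  nonIsolatedVertices : Multigraph n → ℕ
  nonIsolatedVertices g = length (filter (λ i → ¬? (isolated? g i)) (allFin n))

  Adjacent : Multigraph n → Fin n → Fin n → Set
  Adjacent g i j = mult g i j ≢ 0

  -- Adjacency is symmetric, so this is the equivalence relation whose
  -- classes are the connected components.
  Connected : Multigraph n → Fin n → Fin n → Set
  Connected g = Star (Adjacent g)

  InNontrivialComponent : Multigraph n → Fin n → Set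
  InNontrivialComponent g i = ∃[ j ] j ≢ i × Connected g i j

  QuasiConnected : Multigraph n → Set
  QuasiConnected g = ∀ i j →
    InNontrivialComponent g i → InNontrivialComponent g j → Connected g i j

-- Every permutation of Fin (suc n) is determined by the image j of zero
-- and the permutation it induces on the remaining points.
allPermutations : ∀ n → List (Permutation′ n)
allPermutations zero    = idₚ ∷ []
allPermutations (suc n) =
  concatMap (λ j → map (insert zero j) (allPermutations n)) (allFin (suc n))

-- The distinct multigraphs isomorphic to g.
orbit : ∀ {n} → Multigraph n → List (Multigraph n)
orbit {n} g = deduplicate _≟ᵍ_ (map (_• g) (allPermutations n))

------------------------------------------------------------------------
-- Fields

module _ {c ℓ₁ ℓ₂} (K : HeytingField c ℓ₁ ℓ₂) where

  open HeytingField K using (_#_; 0#; 1#; heytingCommutativeRing)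
  open HeytingCommutativeRing heytingCommutativeRing using (commutativeRing)
  open Mult (CommutativeRing.semiring commutativeRing)
    using () renaming (_×_ to _·_)

  -- The apartness x # 0# says that x is a unit; as it is tight, it is the
  -- constructive form of x ≠ 0.
  CharacteristicZero : Set ℓ₂
  CharacteristicZero = ∀ m → (suc m · 1#) # 0#

------------------------------------------------------------------------
-- The invariant ring 𝓘ₙ

module InvariantRing {c ℓ₁ ℓ₂} (K : HeytingField c ℓ₁ ℓ₂) (n : ℕ) where

  open HeytingField K using (Carrier; _≈_; 0#; 1#)
    renaming (_+_ to _+ᴷ_; _*_ to _*ᴷ_)

  -- Polynomials in the variables x_{i,j}: finite formal sums of terms
  -- a xᵍ, the exponents of a monomial forming a multigraph g.  Repeated
  -- and zero terms are allowed; equality compares coefficients.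
  Poly : Set c
  Poly = List (Carrier × Multigraph n)

  coeff : Poly → Multigraph n → Carrier
  coeff []            h = 0#
  coeff ((a , g) ∷ p) h = (if does (g ≟ᵍ h) then a else 0#) +ᴷ coeff p h

  infix 4 _≈ₚ_

  _≈ₚ_ : Poly → Poly → Set ℓ₁
  p ≈ₚ q = ∀ g → coeff p g ≈ coeff q g

  const : Carrier → Poly
  const a = (a , ∅ᵍ) ∷ []

  0ₚ 1ₚ : Poly
  0ₚ = []
  1ₚ = const 1#

  infixl 6 _+ₚ_
  infixl 7 _*ₚ_
  infixr 7 _·ₚ_

  _+ₚ_ : Poly → Poly → Poly
  _+ₚ_ = _++_

  _*ₚ_ : Poly → Poly → Poly
  _*ₚ_ = cartesianProductWith λ { (a , g) (b , h) → (a *ᴷ b , g +ᵍ h) }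

  _·ₚ_ : Carrier → Poly → Poly
  a ·ₚ p = map (λ { (b , g) → (a *ᴷ b , g) }) p

  linearCombination : ∀ {k} → (Fin k → Carrier) → (Fin k → Poly) → Poly
  linearCombination a b = Vector.foldr _+ₚ_ 0ₚ (λ i → a i ·ₚ b i)

  productₚ : List Poly → Poly
  productₚ = foldr _*ₚ_ 1ₚ

  -- Substituting x_{σ i , σ j} for x_{i,j} turns xᵍ into the monomial of σ • g.
  act : Permutation′ n → Poly → Poly
  act σ = map (map₂ (σ •_))

  Invariant : Pred Poly ℓ₁
  Invariant p = ∀ σ → act σ p ≈ₚ p

  Homogeneous : ℕ → Pred Poly ℓ₁
  Homogeneous d p = ∀ g → edges g ≢ d → coeff p g ≈ 0#

  DegreeAtMost : ℕ → Pred Poly ℓ₁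
  DegreeAtMost d p = ∀ g → d < edges g → coeff p g ≈ 0#

  HomogeneousInvariant : ℕ → Pred Poly ℓ₁
  HomogeneousInvariant d p = Invariant p × Homogeneous d p

  InvariantOfDegreeAtMost : ℕ → Pred Poly ℓ₁
  InvariantOfDegreeAtMost d p = Invariant p × DegreeAtMost d p

  𝓞 : Multigraph n → Poly
  𝓞 g = map (1# ,_) (orbit g)

  ----------------------------------------------------------------------
  -- Linear algebra.  Subsets of the polynomial ring are predicates
  -- closed under _≈ₚ_.

  Span : ∀ {ℓ} → Pred Poly ℓ → Pred Poly (c ⊔ ℓ₁ ⊔ ℓ)
  Span B p = ∃[ k ] Σ[ a ∈ (Fin k → Carrier) ] Σ[ b ∈ (Fin k → Poly) ]
    (∀ i → B (b i)) × p ≈ₚ linearCombination a b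

  LinearlyIndependent : ∀ {ℓ} → Pred Poly ℓ → Set (c ⊔ ℓ₁ ⊔ ℓ)
  LinearlyIndependent B = ∀ {k} (a : Fin k → Carrier) (b : Fin k → Poly) →
    (∀ i → B (b i)) →
    (∀ i j → b i ≈ₚ b j → i ≡ j) →
    linearCombination a b ≈ₚ 0ₚ →
    ∀ i → a i ≈ 0#

  record IsBasis {ℓ ℓ′} (V : Pred Poly ℓ) (B : Pred Poly ℓ′) : Set (c ⊔ ℓ₁ ⊔ ℓ ⊔ ℓ′) where
    field
      contained   : B ⊆ V
      spanning    : V ⊆ Span B
      independent : LinearlyIndependent B

  ----------------------------------------------------------------------
  -- Generation of 𝓘ₙ as an algebra

  data Subalgebra {ℓ} (S : Pred Poly ℓ) : Pred Poly (c ⊔ ℓ₁ ⊔ ℓ) where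
    generator : ∀ {p} → S p → Subalgebra S p
    scalar    : ∀ a → Subalgebra S (const a)
    plus      : ∀ {p q} → Subalgebra S p → Subalgebra S q → Subalgebra S (p +ₚ q)
    times     : ∀ {p q} → Subalgebra S p → Subalgebra S q → Subalgebra S (p *ₚ q)
    respects  : ∀ {p q} → p ≈ₚ q → Subalgebra S p → Subalgebra S q

  GeneratesInvariants : ∀ {ℓ} → Pred Poly ℓ → Set (c ⊔ ℓ₁ ⊔ ℓ)
  GeneratesInvariants S = Subalgebra S ≐ Invariant

  Isβ : ℕ → Set (c ⊔ ℓ₁)
  Isβ d = GeneratesInvariants (InvariantOfDegreeAtMost d)
        × (∀ e → GeneratesInvariants (InvariantOfDegreeAtMost e) → d ≤ e)

  ----------------------------------------------------------------------

  -- The invariants 𝓞 c₁ ⋯ 𝓞 cₖ, k ≥ 0.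
  QuasiConnectedProduct : ℕ → Pred Poly ℓ₁
  QuasiConnectedProduct d p = Σ[ cs ∈ List (Multigraph n) ]
    All QuasiConnected cs
    × total (map nonIsolatedVertices cs) ≤ n
    × total (map edges cs) ≡ d
    × p ≈ₚ productₚ (map 𝓞 cs)

  QuasiConnectedOrbitSum : ℕ → Pred Poly ℓ₁
  QuasiConnectedOrbitSum d p = Σ[ g ∈ Multigraph n ]
    QuasiConnected g × edges g ≤ d × p ≈ₚ 𝓞 g

{-# OPTIONS --safe #-}

-- Order multigraphs by their number of non-isolated vertices.  A term of 𝓞 c₁ ⋯ 𝓞 cₖ is a sum of copies
-- of the cᵢ, so it has at most n₁ + ⋯ + nₖ non-isolated vertices, with equality exactly when the copies are
-- vertex-disjoint; all sums of disjoint copies are isomorphic, and they exist as n₁ + ⋯ + nₖ ≤ n.  Hence the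
-- product is a positive integer multiple of 𝓞 (c₁ ⊔ ⋯ ⊔ cₖ) plus orbit sums of graphs with fewer non-isolated
-- vertices.  Splitting a graph into connected components is unique up to order and isomorphism, so the
-- products are unitriangular, up to positive integers, with respect to the orbit sums, which span the
-- invariants.  In (ii), an invariant of degree at most β is a combination of products whose factors have
-- at most β edges.

module Submission where

open import Defs
open import Algebra.Apartness.Bundles using (HeytingField; HeytingCommutativeRing)
open import Algebra.Bundles using (CommutativeMonoid; CommutativeRing)
import Algebra.Apartness.Properties.HeytingCommutativeRing as HeytingCommutativeRingProperties
import Algebra.Properties.CommutativeSemigroup as CommutativeSemigroupProperties
import Algebra.Properties.Ring as RingProperties
import Algebra.Properties.Semiring.Mult as Mult
open import Algebra.Structures.Biased using (isCommutativeMonoidˡ)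
open import Data.Bool.Base using (Bool; true; false; if_then_else_; _∧_)
open import Data.Bool.Properties using (∧-comm; if-eta)
open import Data.Fin.Base using (Fin; zero; suc; punchIn) renaming (_<_ to _<ᶠ_)
open import Data.Fin.Permutation
  using (Permutation′; _⟨$⟩ˡ_; _⟨$⟩ʳ_; inverseˡ; inverseʳ; flip; _∘ₚ_; transpose; insert; remove;
         insert-remove; insert-punchIn)
  renaming (id to idₚ)
open import Data.Fin.Properties using (any?; _<?_; <-cmp; suc-injective) renaming (_≟_ to _≟ᶠ_)
open import Data.Fin.Subset using (Subset; ⁅_⁆; _∪_; ∁; _⊃_) renaming (_∈_ to _∈ˢ_; _∉_ to _∉ˢ_)
open import Data.Fin.Subset.Induction using (⊃-wellFounded)
open import Data.Fin.Subset.Properties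
  using (_∈?_; x∈⁅x⁆; x∈⁅y⁆⇒x≡y; x∈p∪q⁻; p⊆p∪q; q⊆p∪q; x∈∁p⇒x∉p; x∉p⇒x∈∁p)
open import Data.List.Base
  using (List; []; _∷_; _++_; map; foldr; length; filter; tabulate; allFin; concatMap; deduplicate)
open import Data.List.Membership.Propositional using (_∈_; lose; find)
open import Data.List.Membership.Propositional.Properties
  using (∈-allFin; ∈-map⁺; ∈-concatMap⁺; ∈-cartesianProductWith⁻)
import Data.List.Membership.Setoid as SetoidMembership
open import Data.List.Membership.Setoid.Properties using (∈-deduplicate⁺)
open import Data.List.Properties using (length-filter; length-tabulate; ++-assoc)
open import Data.List.Relation.Binary.Pointwise.Base using (Pointwise; []; _∷_)
import Data.List.Relation.Binary.Pointwise as Pointwise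
open import Data.List.Relation.Unary.All using (All; []; _∷_)
import Data.List.Relation.Unary.All as All
import Data.List.Relation.Unary.All.Properties as Allₚ
open import Data.List.Relation.Unary.AllPairs using (_∷_)
open import Data.List.Relation.Unary.Any using (here; there)
import Data.List.Relation.Unary.Any as Any
import Data.List.Relation.Unary.Any.Properties as Anyₚ
import Data.List.Relation.Unary.Unique.Setoid as UniqueSetoid
open import Data.List.Relation.Unary.Unique.DecSetoid.Properties using (deduplicate-!)
open import Data.Nat.Base using (ℕ; zero; suc; NonZero; _+_; _*_; _≤_; _<_; _∸_; z≤n; s≤s)
open import Data.Nat.Induction using (<-wellFounded)
open import Data.Nat.ListAction using () renaming (sum to total)
open import Data.Nat.Properties
  using (+-0-commutativeMonoid; +-assoc; +-comm; +-identityʳ; +-cancelˡ-≡; +-mono-≤; +-mono-<-≤; +-mono-≤-<;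
         +-monoʳ-≤; +-monoʳ-<; *-cancelˡ-≡; ≤-refl; ≤-reflexive; ≤-trans; ≤-antisym; ≤⇒≯; <-≤-trans; ≤-<-trans;
         m≤m+n; m≤n+m; m+n≤o⇒m≤o; m+n≤o⇒n≤o; m+n≡0⇒m≡0; m+n≡0⇒n≡0; ∸-monoʳ-<; ≰⇒>; _≟_; _≤?_; module ≤-Reasoning)
open import Algebra.Properties.CommutativeMonoid.Sum +-0-commutativeMonoid
  using (sum; sum-cong-≗; ∑-distrib-+; ∑-comm; sum-permute)
open import Data.Product.Base using (∃-syntax; ∃₂; _×_; _,_; proj₁; proj₂)
open import Data.Sum.Base using (_⊎_; inj₁; inj₂; [_,_]′)
open import Data.Unit.Base using (⊤; tt)
import Data.Vec.Functional as Vector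
open import Function.Base using (_∘_; id; case_of_)
open import Function.Bundles using (mk⇔)
open import Induction.WellFounded using (Acc; acc)
open import Level using (0ℓ; _⊔_)
open import Relation.Binary.Bundles using (Setoid; DecSetoid)
open import Relation.Binary.Construct.Closure.ReflexiveTransitive using (ε; _◅_; _◅◅_; gmap; reverse)
open import Relation.Binary.Definitions using (tri<; tri≈; tri>)
open import Relation.Binary.PropositionalEquality
  using (_≡_; _≢_; refl; sym; trans; cong; cong₂; subst; module ≡-Reasoning)
  renaming (setoid to ≡-setoid)
import Relation.Binary.Reasoning.Setoid as SetoidReasoning
open import Relation.Nullary.Decidable
  using (Dec; yes; no; does; ¬?; _×-dec_; _⊎-dec_; dec-true; dec-false; decidable-stable; map′; does-⇔)
open import Relation.Nullary.Negation using (¬_; contradiction)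
open import Relation.Unary using (Pred; _⊆_)

-- Over a Heyting field the vanishing of a coefficient cannot be decided, so every case distinction
-- is made on graphs: isomorphism is decided by search through the permutations, and a graph either
-- occurs among the listed terms of a product or not. All listed terms of orbit sums have
-- coefficient 1, so nothing cancels in their products: an occurring term has a positive integer as
-- coefficient, a unit in characteristic zero. Its value is never computed; it can exceed 1, as the
-- square of the orbit sum of a single edge contains each pair of disjoint edges twice.
--
-- The basis consists of polynomials, not of lists of graphs. Reordering the factors, replacing them
-- by isomorphic graphs or inserting the empty graph, which is quasi-connected, changes the list but
-- not the product. Independence therefore rests on the fact that products with isomorphic leading
-- graphs are equal as polynomials, and uniqueness of components is needed only to this extent.
--
-- Both parts use one triangular argument, stated for an arbitrary subspace that contains the
-- products: their span in (i), the generated subalgebra in (ii).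

private variable
  n : ℕ

-- Finite sums of natural numbers

sum-mono-≤ : (f g : Fin n → ℕ) → (∀ i → f i ≤ g i) → sum f ≤ sum g
sum-mono-≤ {zero}  f g f≤g = z≤n
sum-mono-≤ {suc n} f g f≤g = +-mono-≤ (f≤g zero) (sum-mono-≤ (f ∘ suc) (g ∘ suc) (f≤g ∘ suc))

sum-mono-< : (f g : Fin n → ℕ) → (∀ i → f i ≤ g i) → ∀ i → f i < g i → sum f < sum g
sum-mono-< f g f≤g zero    fi<gi = +-mono-<-≤ fi<gi (sum-mono-≤ (f ∘ suc) (g ∘ suc) (f≤g ∘ suc))
sum-mono-< f g f≤g (suc i) fi<gi = +-mono-≤-< (f≤g zero) (sum-mono-< (f ∘ suc) (g ∘ suc) (f≤g ∘ suc) i fi<gi)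

sum-cong : (f g : Fin n → ℕ) → (∀ i → f i ≡ g i) → sum f ≡ sum g
sum-cong f g = sum-cong-≗ {_} {f} {g}

length-filter-tabulate : ∀ {a p} {A : Set a} {P : A → Set p} (P? : ∀ x → Dec (P x)) (f : Fin n → A) →
  length (filter P? (tabulate f)) ≡ sum (λ i → if does (P? (f i)) then 1 else 0)
length-filter-tabulate {zero}  P? f = refl
length-filter-tabulate {suc n} P? f with does (P? (f zero))
... | true  = cong suc (length-filter-tabulate P? (f ∘ suc))
... | false = length-filter-tabulate P? (f ∘ suc)

-- Isolated and non-isolated vertices

module _ {n : ℕ} where

  isolated-resp : (g h : Multigraph n) → g ≈ᵍ h → ∀ {i} → Isolated g i → Isolated h i
  isolated-resp g h g≈h {i} iso j = trans (sym (g≈h i j)) (iso j)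

  isolated-+ : (g h : Multigraph n) → ∀ {i} → Isolated g i → Isolated h i → Isolated (g +ᵍ h) i
  isolated-+ g h gi hi j = cong₂ _+_ (gi j) (hi j)

  isolated-+ˡ : (g h : Multigraph n) → ∀ {i} → Isolated (g +ᵍ h) i → Isolated g i
  isolated-+ˡ g h {i} iso j = m+n≡0⇒m≡0 (mult g i j) (iso j)

  isolated-+ʳ : (g h : Multigraph n) → ∀ {i} → Isolated (g +ᵍ h) i → Isolated h i
  isolated-+ʳ g h {i} iso j = m+n≡0⇒n≡0 (mult g i j) (iso j)

  isolated-•⁺ : ∀ σ (g : Multigraph n) {i} → Isolated g (σ ⟨$⟩ˡ i) → Isolated (σ • g) i
  isolated-•⁺ σ g iso j = iso (σ ⟨$⟩ˡ j)

  isolated-•⁻ : ∀ σ (g : Multigraph n) {i} → Isolated (σ • g) i → Isolated g (σ ⟨$⟩ˡ i)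
  isolated-•⁻ σ g {i} iso j = subst (λ k → mult g (σ ⟨$⟩ˡ i) k ≡ 0) (inverseˡ σ) (iso (σ ⟨$⟩ʳ j))

  adjacent⇒¬isolated : (g : Multigraph n) → ∀ {i j} → Adjacent g i j → ¬ Isolated g i
  adjacent⇒¬isolated g {j = j} adj iso = adj (iso j)

  adjacent-sym : (g : Multigraph n) → ∀ {i j} → Adjacent g i j → Adjacent g j i
  adjacent-sym g {i} {j} adj ji≡0 = adj (trans (mult-sym g i j) ji≡0)

  ¬isolated⇒adjacent : (g : Multigraph n) → ∀ {i} → ¬ Isolated g i → ∃[ j ] Adjacent g i j
  ¬isolated⇒adjacent g {i} ¬iso with any? (λ j → ¬? (mult g i j ≟ 0))
  ... | yes p = p
  ... | no ¬p = contradiction (λ j → decidable-stable (mult g i j ≟ 0) (λ adj → ¬p (j , adj))) ¬iso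

  -- Turns the vertex count into a sum of zeros and ones, which can be permuted, split and compared
  -- pointwise.
  indicator : Multigraph n → Fin n → ℕ
  indicator g i = if does (¬? (isolated? g i)) then 1 else 0

  indicator-isolated : (g : Multigraph n) → ∀ {i} → Isolated g i → indicator g i ≡ 0
  indicator-isolated g {i} iso =
    cong (if_then 1 else 0) (dec-false (¬? (isolated? g i)) (λ ¬iso → ¬iso iso))

  indicator-¬isolated : (g : Multigraph n) → ∀ {i} → ¬ Isolated g i → indicator g i ≡ 1
  indicator-¬isolated g {i} ¬iso = cong (if_then 1 else 0) (dec-true (¬? (isolated? g i)) ¬iso)

  indicator≤1 : (g : Multigraph n) → ∀ i → indicator g i ≤ 1
  indicator≤1 g i with does (isolated? g i)
  ... | true  = z≤n
  ... | false = ≤-refl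

  -- Two separate vertices `i` and `j` are allowed, so that a graph can also be compared with a
  -- relabelled copy.
  indicator-mono : (g h : Multigraph n) → ∀ {i j} → (Isolated h j → Isolated g i) → indicator g i ≤ indicator h j
  indicator-mono g h {i} {j} imp = case isolated? h j of λ where
    (yes hj) → subst (_≤ indicator h j) (sym (indicator-isolated g (imp hj))) z≤n
    (no ¬hj) → subst (indicator g i ≤_) (sym (indicator-¬isolated h ¬hj)) (indicator≤1 g i)

  indicator-+ : (g h : Multigraph n) → ∀ i → indicator (g +ᵍ h) i ≤ indicator g i + indicator h i
  indicator-+ g h i = case isolated? g i of λ where
    (yes gi) → ≤-trans (indicator-mono (g +ᵍ h) h (isolated-+ g h gi)) (m≤n+m _ _)
    (no ¬gi) → ≤-trans (indicator≤1 (g +ᵍ h) i)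
      (subst (λ k → 1 ≤ k + indicator h i) (sym (indicator-¬isolated g ¬gi)) (m≤m+n 1 _))

  nonIsolatedVertices≡sum : (g : Multigraph n) → nonIsolatedVertices g ≡ sum (indicator g)
  nonIsolatedVertices≡sum g = length-filter-tabulate (λ i → ¬? (isolated? g i)) id

  nonIsolatedVertices-mono-≤ : (g h : Multigraph n) → (∀ {i} → Isolated h i → Isolated g i) →
    nonIsolatedVertices g ≤ nonIsolatedVertices h
  nonIsolatedVertices-mono-≤ g h imp
    rewrite nonIsolatedVertices≡sum g | nonIsolatedVertices≡sum h =
    sum-mono-≤ (indicator g) (indicator h) λ i → indicator-mono g h imp

  nonIsolatedVertices-mono-< : (g h : Multigraph n) → (∀ {i} → Isolated h i → Isolated g i) →
    ∀ {i} → Isolated g i → ¬ Isolated h i → nonIsolatedVertices g < nonIsolatedVertices h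
  nonIsolatedVertices-mono-< g h imp {i} gi ¬hi
    rewrite nonIsolatedVertices≡sum g | nonIsolatedVertices≡sum h =
    sum-mono-< (indicator g) (indicator h) (λ j → indicator-mono g h imp) i
      (subst (_< indicator h i) (sym (indicator-isolated g gi))
        (subst (0 <_) (sym (indicator-¬isolated h ¬hi)) (s≤s z≤n)))

  nonIsolatedVertices-cong : (g h : Multigraph n) → g ≈ᵍ h → nonIsolatedVertices g ≡ nonIsolatedVertices h
  nonIsolatedVertices-cong g h g≈h = ≤-antisym
    (nonIsolatedVertices-mono-≤ g h (isolated-resp h g λ i j → sym (g≈h i j)))
    (nonIsolatedVertices-mono-≤ h g (isolated-resp g h g≈h))

  nonIsolatedVertices-• : ∀ σ (g : Multigraph n) → nonIsolatedVertices (σ • g) ≡ nonIsolatedVertices g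
  nonIsolatedVertices-• σ g = begin
    nonIsolatedVertices (σ • g)              ≡⟨ nonIsolatedVertices≡sum (σ • g) ⟩
    sum (indicator (σ • g))                  ≡⟨ sum-cong (indicator (σ • g)) (indicator g ∘ (σ ⟨$⟩ˡ_)) (λ i → ≤-antisym
                                                  (indicator-mono (σ • g) g (isolated-•⁺ σ g))
                                                  (indicator-mono g (σ • g) (isolated-•⁻ σ g))) ⟩
    sum (indicator g ∘ (σ ⟨$⟩ˡ_))            ≡⟨ sum-permute (indicator g) (flip σ) ⟨
    sum (indicator g)                        ≡⟨ nonIsolatedVertices≡sum g ⟨
    nonIsolatedVertices g                    ∎
    where open ≡-Reasoning

  nonIsolatedVertices≤n : (g : Multigraph n) → nonIsolatedVertices g ≤ n
  nonIsolatedVertices≤n g = ≤-trans (length-filter (λ i → ¬? (isolated? g i)) (allFin n))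
    (≤-reflexive (length-tabulate (id {A = Fin n})))

  ∃-isolated : (g : Multigraph n) → nonIsolatedVertices g < n → ∃[ i ] Isolated g i
  ∃-isolated g v<n with any? (isolated? g)
  ... | yes p = p
  ... | no ¬p = contradiction v<n (≤⇒≯ (begin
    n                      ≡⟨ sum-ones n ⟨
    sum {n} (λ _ → 1)      ≡⟨ sum-cong (indicator g) (λ _ → 1) (λ i → indicator-¬isolated g (λ gi → ¬p (i , gi))) ⟨
    sum (indicator g)      ≡⟨ nonIsolatedVertices≡sum g ⟨
    nonIsolatedVertices g  ∎))
    where
    open ≤-Reasoning
    sum-ones : ∀ m → sum {m} (λ _ → 1) ≡ m
    sum-ones zero    = refl
    sum-ones (suc m) = cong suc (sum-ones m)

  -- Vertex-disjoint graphs

  VertexDisjoint : Multigraph n → Multigraph n → Set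
  VertexDisjoint g h = ∀ i → Isolated g i ⊎ Isolated h i

  vertexDisjoint? : ∀ g h → VertexDisjoint g h ⊎ ∃[ i ] ¬ Isolated g i × ¬ Isolated h i
  vertexDisjoint? g h with any? (λ i → ¬? (isolated? g i) ×-dec ¬? (isolated? h i))
  ... | yes p = inj₂ p
  ... | no ¬p = inj₁ λ i → case isolated? g i of λ where
    (yes gi) → inj₁ gi
    (no ¬gi) → inj₂ (decidable-stable (isolated? h i) λ ¬hi → ¬p (i , ¬gi , ¬hi))

  private
    nonIsolatedVertices-sum : (g h : Multigraph n) →
      nonIsolatedVertices g + nonIsolatedVertices h ≡ sum (λ i → indicator g i + indicator h i)
    nonIsolatedVertices-sum g h = trans
      (cong₂ _+_ (nonIsolatedVertices≡sum g) (nonIsolatedVertices≡sum h))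
      (sym (∑-distrib-+ (indicator g) (indicator h)))

  nonIsolatedVertices-+-≤ : (g h : Multigraph n) →
    nonIsolatedVertices (g +ᵍ h) ≤ nonIsolatedVertices g + nonIsolatedVertices h
  nonIsolatedVertices-+-≤ g h
    rewrite nonIsolatedVertices-sum g h | nonIsolatedVertices≡sum (g +ᵍ h) =
    sum-mono-≤ (indicator (g +ᵍ h)) (λ i → indicator g i + indicator h i) (indicator-+ g h)

  -- The shared vertex `i` counts twice on the right but only once on the left.
  nonIsolatedVertices-+-< : (g h : Multigraph n) → ∀ {i} → ¬ Isolated g i → ¬ Isolated h i →
    nonIsolatedVertices (g +ᵍ h) < nonIsolatedVertices g + nonIsolatedVertices h
  nonIsolatedVertices-+-< g h {i} ¬gi ¬hi
    rewrite nonIsolatedVertices-sum g h | nonIsolatedVertices≡sum (g +ᵍ h) =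
    sum-mono-< (indicator (g +ᵍ h)) (λ i → indicator g i + indicator h i) (indicator-+ g h) i (≤-reflexive (begin
      suc (indicator (g +ᵍ h) i)      ≡⟨ cong suc (indicator-¬isolated (g +ᵍ h) (¬gi ∘ isolated-+ˡ g h)) ⟩
      2                               ≡⟨ cong₂ _+_ (indicator-¬isolated g ¬gi) (indicator-¬isolated h ¬hi) ⟨
      indicator g i + indicator h i   ∎))
    where open ≡-Reasoning

  nonIsolatedVertices-+-disjoint : (g h : Multigraph n) → VertexDisjoint g h →
    nonIsolatedVertices (g +ᵍ h) ≡ nonIsolatedVertices g + nonIsolatedVertices h
  nonIsolatedVertices-+-disjoint g h disj = ≤-antisym (nonIsolatedVertices-+-≤ g h) bound
    where
    pointwise : ∀ i → indicator g i + indicator h i ≤ indicator (g +ᵍ h) i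
    pointwise i with disj i
    ... | inj₁ gi rewrite indicator-isolated g gi = indicator-mono h (g +ᵍ h) (isolated-+ʳ g h)
    ... | inj₂ hi rewrite indicator-isolated h hi | +-identityʳ (indicator g i) =
      indicator-mono g (g +ᵍ h) (isolated-+ˡ g h)
    bound : nonIsolatedVertices g + nonIsolatedVertices h ≤ nonIsolatedVertices (g +ᵍ h)
    bound rewrite nonIsolatedVertices-sum g h | nonIsolatedVertices≡sum (g +ᵍ h) =
      sum-mono-≤ (λ i → indicator g i + indicator h i) (indicator (g +ᵍ h)) pointwise

-- Isomorphism and edges

  infix 4 _≅_

  -- A record, because `_≈ᵍ_` unfolds to a family of equations from which the two graphs could not
  -- be recovered by unification.
  record _≅_ (g h : Multigraph n) : Set where
    constructor iso
    field
      perm : Permutation′ n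
      •-≈  : perm • g ≈ᵍ h

  module _ (g h : Multigraph n) (σ : Permutation′ n) where

    -- The action is defined through the inverse of `σ`. The forward form is the convenient one when
    -- a permutation is known by the images of vertices.
    •-≈-intro : (∀ i j → mult h (σ ⟨$⟩ʳ i) (σ ⟨$⟩ʳ j) ≡ mult g i j) → σ • g ≈ᵍ h
    •-≈-intro eq i j = trans (sym (eq (σ ⟨$⟩ˡ i) (σ ⟨$⟩ˡ j)))
      (cong₂ (mult h) (inverseʳ σ) (inverseʳ σ))

    •-≈-elim : σ • g ≈ᵍ h → ∀ i j → mult h (σ ⟨$⟩ʳ i) (σ ⟨$⟩ʳ j) ≡ mult g i j
    •-≈-elim eq i j = trans (sym (eq (σ ⟨$⟩ʳ i) (σ ⟨$⟩ʳ j)))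
      (cong₂ (mult g) (inverseˡ σ) (inverseˡ σ))

    ¬isolated-•-≈ : σ • g ≈ᵍ h → ∀ {i} → ¬ Isolated g i → ¬ Isolated h (σ ⟨$⟩ʳ i)
    ¬isolated-•-≈ eq {i} ¬gi hσi = ¬gi λ j → trans (sym (•-≈-elim eq i j)) (hσi (σ ⟨$⟩ʳ j))

  ≈ᵍ⇒≅ : {g h : Multigraph n} → g ≈ᵍ h → g ≅ h
  ≈ᵍ⇒≅ g≈h = iso idₚ g≈h

  ≅-refl : {g : Multigraph n} → g ≅ g
  ≅-refl = ≈ᵍ⇒≅ λ i j → refl

  ≅-sym : {g h : Multigraph n} → g ≅ h → h ≅ g
  ≅-sym {g} {h} (iso σ eq) = iso (flip σ) (•-≈-elim g h σ eq)

  ≅-trans : {g h k : Multigraph n} → g ≅ h → h ≅ k → g ≅ k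
  ≅-trans (iso σ eq) (iso τ eq′) = iso (σ ∘ₚ τ) λ i j → trans (eq (τ ⟨$⟩ˡ i) (τ ⟨$⟩ˡ j)) (eq′ i j)

  •-≅ : ∀ σ (g : Multigraph n) → g ≅ σ • g
  •-≅ σ g = iso σ λ i j → refl

  nonIsolatedVertices-≅ : {g h : Multigraph n} → g ≅ h → nonIsolatedVertices g ≡ nonIsolatedVertices h
  nonIsolatedVertices-≅ {g} {h} (iso σ eq) =
    trans (sym (nonIsolatedVertices-• σ g)) (nonIsolatedVertices-cong (σ • g) h eq)

  upper : Multigraph n → Fin n → Fin n → ℕ
  upper g i j = if does (i <? j) then mult g i j else 0

  edges-cong : (g h : Multigraph n) → g ≈ᵍ h → edges g ≡ edges h
  edges-cong g h g≈h = sum-cong (sum ∘ upper g) (sum ∘ upper h) λ i →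
    sum-cong (upper g i) (upper h i) λ j → cong (if does (i <? j) then_else 0) (g≈h i j)

  edges-+ : (g h : Multigraph n) → edges (g +ᵍ h) ≡ edges g + edges h
  edges-+ g h = trans
    (sum-cong (sum ∘ upper (g +ᵍ h)) (λ i → sum (upper g i) + sum (upper h i)) λ i → trans
      (sum-cong (upper (g +ᵍ h) i) (λ j → upper g i j + upper h i j) λ j → if-+ (does (i <? j)))
      (∑-distrib-+ (upper g i) (upper h i)))
    (∑-distrib-+ (sum ∘ upper g) (sum ∘ upper h))
    where
    if-+ : ∀ b {x y} → (if b then x + y else 0) ≡ (if b then x else 0) + (if b then y else 0)
    if-+ true  = refl
    if-+ false = refl

  -- Relabelling does not respect the condition `i <? j` in `edges`. The sum over the whole matrix
  -- is invariant under relabelling and counts every edge twice, once in each triangle.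
  edges-double : (g : Multigraph n) → edges g + edges g ≡ sum (λ i → sum (mult g i))
  edges-double g = begin
    sum (sum ∘ upper g) + sum (sum ∘ upper g)
      ≡⟨ cong (edges g +_) (∑-comm (upper g)) ⟩
    sum (sum ∘ upper g) + sum (sum ∘ lower)
      ≡⟨ ∑-distrib-+ (sum ∘ upper g) (sum ∘ lower) ⟨
    sum (λ i → sum (upper g i) + sum (lower i))
      ≡⟨ sum-cong (λ i → sum (upper g i) + sum (lower i)) (sum ∘ mult g) (λ i → trans
           (sym (∑-distrib-+ (upper g i) (lower i)))
           (sum-cong (λ j → upper g i j + lower i j) (mult g i) (upper+lower i))) ⟩
    sum (sum ∘ mult g) ∎
    where
    open ≡-Reasoning
    lower : Fin n → Fin n → ℕ
    lower i j = upper g j i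
    upper-< : ∀ {i j} → i <ᶠ j → upper g i j ≡ mult g i j
    upper-< {i} {j} i<j = cong (if_then mult g i j else 0) (dec-true (i <? j) i<j)
    upper-≮ : ∀ {i j} → ¬ i <ᶠ j → upper g i j ≡ 0
    upper-≮ {i} {j} i≮j = cong (if_then mult g i j else 0) (dec-false (i <? j) i≮j)
    upper+lower : ∀ i j → upper g i j + lower i j ≡ mult g i j
    upper+lower i j with <-cmp i j
    ... | tri< i<j _ j≮i = trans (cong₂ _+_ (upper-< i<j) (upper-≮ j≮i)) (+-identityʳ _)
    ... | tri≈ i≮j refl j≮i = trans (cong₂ _+_ (upper-≮ i≮j) (upper-≮ j≮i)) (sym (mult-irrefl g i))
    ... | tri> i≮j _ j<i = trans (cong₂ _+_ (upper-≮ i≮j) (upper-< j<i)) (mult-sym g j i)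

  edges-• : ∀ σ (g : Multigraph n) → edges (σ • g) ≡ edges g
  edges-• σ g = halve (begin
    edges (σ • g) + edges (σ • g)            ≡⟨ edges-double (σ • g) ⟩
    sum (λ i → sum (mult (σ • g) i))         ≡⟨ sum-cong (λ i → sum (mult g (σ ⟨$⟩ˡ i))) (λ i → sum (mult (σ • g) i))
                                                  (λ i → sum-permute (mult g (σ ⟨$⟩ˡ i)) (flip σ)) ⟨
    sum (λ i → sum (mult g (σ ⟨$⟩ˡ i)))      ≡⟨ sum-permute (sum ∘ mult g) (flip σ) ⟨
    sum (sum ∘ mult g)                       ≡⟨ edges-double g ⟨
    edges g + edges g                        ∎)
    where
    open ≡-Reasoning
    halve : ∀ {a b} → a + a ≡ b + b → a ≡ b
    halve {a} {b} eq = *-cancelˡ-≡ a b 2 (subst (λ z → z ≡ 2 * b) (cong (a +_) (sym (+-identityʳ a)))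
      (trans eq (cong (b +_) (sym (+-identityʳ b)))))

  edges-≅ : {g h : Multigraph n} → g ≅ h → edges g ≡ edges h
  edges-≅ {g} {h} (iso σ eq) = trans (sym (edges-• σ g)) (edges-cong (σ • g) h eq)

  quasiConnected-≅ : {g h : Multigraph n} → g ≅ h → QuasiConnected g → QuasiConnected h
  quasiConnected-≅ {g} {h} (iso σ eq) qc i j nti ntj =
    back (gmap (σ ⟨$⟩ʳ_) push (qc _ _ (pullNT nti) (pullNT ntj)))
    where
    push : ∀ {a b} → Adjacent g a b → Adjacent h (σ ⟨$⟩ʳ a) (σ ⟨$⟩ʳ b)
    push adj = adj ∘ trans (sym (•-≈-elim g h σ eq _ _))
    pull : ∀ {a b} → Adjacent h a b → Adjacent g (σ ⟨$⟩ˡ a) (σ ⟨$⟩ˡ b)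
    pull {a} {b} adj = adj ∘ trans (sym (eq a b))
    pullNT : ∀ {a} → InNontrivialComponent h a → InNontrivialComponent g (σ ⟨$⟩ˡ a)
    pullNT (b , b≢a , conn) = σ ⟨$⟩ˡ b ,
      (λ e → b≢a (trans (sym (inverseʳ σ)) (trans (cong (σ ⟨$⟩ʳ_) e) (inverseʳ σ)))) ,
      gmap (σ ⟨$⟩ˡ_) pull conn
    back : Connected h (σ ⟨$⟩ʳ (σ ⟨$⟩ˡ i)) (σ ⟨$⟩ʳ (σ ⟨$⟩ˡ j)) → Connected h i j
    back rewrite inverseʳ σ {i} | inverseʳ σ {j} = id

-- Extending partial injections to permutations

transpose-left : (i j : Fin n) → transpose i j ⟨$⟩ʳ i ≡ j
transpose-left i j rewrite dec-true (i ≟ᶠ i) refl = refl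

transpose-other : (i j : Fin n) → ∀ {k} → k ≢ i → k ≢ j → transpose i j ⟨$⟩ʳ k ≡ k
transpose-other i j {k} k≢i k≢j rewrite dec-false (k ≟ᶠ i) k≢i | dec-false (k ≟ᶠ j) k≢j = refl

⟨$⟩ʳ-injective : (σ : Permutation′ n) → ∀ {i j} → σ ⟨$⟩ʳ i ≡ σ ⟨$⟩ʳ j → i ≡ j
⟨$⟩ʳ-injective σ eq = trans (sym (inverseˡ σ)) (trans (cong (σ ⟨$⟩ˡ_) eq) (inverseˡ σ))

module _ {p} {P : Fin n → Set p} (P? : ∀ i → Dec (P i)) (f : Fin n → Fin n)
         (f-injective : ∀ {i j} → P i → P j → f i ≡ f j → i ≡ j) where

  private
    -- One vertex at a time: transposing the current image of x with f x leaves the images already fixed untouched.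
    extend : (xs : List (Fin n)) → ∃[ ρ ] (∀ {x} → x ∈ xs → P x → ρ ⟨$⟩ʳ x ≡ f x)
    extend [] = idₚ , λ ()
    extend (x ∷ xs) with extend xs | P? x
    ... | ρ , agree | no ¬px = ρ , λ where
      (here refl) px → contradiction px ¬px
      (there y∈)  py → agree y∈ py
    ... | ρ , agree | yes px = ρ ∘ₚ transpose (ρ ⟨$⟩ʳ x) (f x) , λ where
      (here refl)    _  → transpose-left (ρ ⟨$⟩ʳ x) (f x)
      (there {y} y∈) py → later (agree y∈ py) py
     where
      later : ∀ {y} → ρ ⟨$⟩ʳ y ≡ f y → P y → transpose (ρ ⟨$⟩ʳ x) (f x) ⟨$⟩ʳ (ρ ⟨$⟩ʳ y) ≡ f y
      later {y} eq py with y ≟ᶠ x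
      ... | yes refl = transpose-left (ρ ⟨$⟩ʳ x) (f x)
      ... | no y≢x = trans
        (transpose-other (ρ ⟨$⟩ʳ x) (f x) (y≢x ∘ ⟨$⟩ʳ-injective ρ)
          (λ ρy≡fx → y≢x (f-injective py px (trans (sym eq) ρy≡fx))))
        eq

  -- Needed to merge isomorphisms of disjoint graphs: together they prescribe images only for the
  -- non-isolated vertices.
  partialInjection-extends : ∃[ ρ ] (∀ {x} → P x → ρ ⟨$⟩ʳ x ≡ f x)
  partialInjection-extends = let ρ , agree = extend (allFin n) in ρ , agree (∈-allFin _)

-- Disjoint unions

module _ {n : ℕ} where

  -- The point is that `ρ` cannot send an isolated vertex of `g` to a non-isolated vertex of `h`.
  -- Such a vertex of `h` is the image under `σ` of some non-isolated `k`; there `ρ` agrees with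
  -- `σ`, and injectivity of `ρ` identifies `k` with the isolated vertex.
  •-≈-agree : (g h : Multigraph n) (σ ρ : Permutation′ n) → σ • g ≈ᵍ h →
    (∀ {x} → ¬ Isolated g x → ρ ⟨$⟩ʳ x ≡ σ ⟨$⟩ʳ x) → ρ • g ≈ᵍ h
  •-≈-agree g h σ ρ eq agree = •-≈-intro g h ρ same
    where
    isolated-ρ : ∀ {i} → Isolated g i → Isolated h (ρ ⟨$⟩ʳ i)
    isolated-ρ {i} gi = decidable-stable (isolated? h (ρ ⟨$⟩ʳ i)) λ ¬hρi →
      let k      = σ ⟨$⟩ˡ (ρ ⟨$⟩ʳ i)
          ¬gk gk = ¬hρi (isolated-resp (σ • g) h eq (isolated-•⁺ σ g gk))
          k≡i    = ⟨$⟩ʳ-injective ρ (trans (agree ¬gk) (inverseʳ σ))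
      in ¬gk (subst (Isolated g) (sym k≡i) gi)
    same : ∀ i j → mult h (ρ ⟨$⟩ʳ i) (ρ ⟨$⟩ʳ j) ≡ mult g i j
    same i j with isolated? g i | isolated? g j
    ... | yes gi | _      = trans (isolated-ρ gi _) (sym (gi j))
    ... | no _   | yes gj = trans (mult-sym h _ _) (trans (isolated-ρ gj _) (trans (sym (gj i)) (mult-sym g j i)))
    ... | no ¬gi | no ¬gj = trans (cong₂ (mult h) (agree ¬gi) (agree ¬gj)) (•-≈-elim g h σ eq i j)

  -- The map `f` follows `σ` on the vertices of `g` and `τ` on those of `h`. Disjointness of the
  -- sources makes the two prescriptions compatible, disjointness of the targets makes `f` injective
  -- where it matters.
  +ᵍ-≅ : (g h g′ h′ : Multigraph n) → VertexDisjoint g h → VertexDisjoint g′ h′ →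
    g ≅ g′ → h ≅ h′ → g +ᵍ h ≅ g′ +ᵍ h′
  +ᵍ-≅ g h g′ h′ disj disj′ (iso σ eq) (iso τ eq′) = iso ρ λ i j → cong₂ _+_
    (•-≈-agree g g′ σ ρ eq (λ ¬gx → trans (agree (inj₁ ¬gx)) (f-g ¬gx)) i j)
    (•-≈-agree h h′ τ ρ eq′ (λ ¬hx → trans (agree (inj₂ ¬hx)) (f-h ¬hx)) i j)
    where
    P : Fin n → Set
    P x = ¬ Isolated g x ⊎ ¬ Isolated h x
    P? : ∀ x → Dec (P x)
    P? x = ¬? (isolated? g x) ⊎-dec ¬? (isolated? h x)
    f : Fin n → Fin n
    -- Vertices isolated in both graphs also take the value of `τ`; this choice is arbitrary, since
    -- `P` excludes them.
    f x = if does (isolated? g x) then τ ⟨$⟩ʳ x else σ ⟨$⟩ʳ x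
    f-g : ∀ {x} → ¬ Isolated g x → f x ≡ σ ⟨$⟩ʳ x
    f-g {x} ¬gx = cong (if_then τ ⟨$⟩ʳ x else σ ⟨$⟩ʳ x) (dec-false (isolated? g x) ¬gx)
    f-h : ∀ {x} → ¬ Isolated h x → f x ≡ τ ⟨$⟩ʳ x
    f-h {x} ¬hx = cong (if_then τ ⟨$⟩ʳ x else σ ⟨$⟩ʳ x) (dec-true (isolated? g x)
      ([ id , (λ hx → contradiction hx ¬hx) ]′ (disj x)))
    disjoint-images : ∀ {x y} → ¬ Isolated g x → ¬ Isolated h y → σ ⟨$⟩ʳ x ≢ τ ⟨$⟩ʳ y
    disjoint-images {x} {y} ¬gx ¬hy σx≡τy = [ ¬isolated-•-≈ g g′ σ eq ¬gx ,
      (λ h′σx → ¬isolated-•-≈ h h′ τ eq′ ¬hy (subst (Isolated h′) σx≡τy h′σx)) ]′ (disj′ (σ ⟨$⟩ʳ x))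
    f-injective : ∀ {x y} → P x → P y → f x ≡ f y → x ≡ y
    f-injective (inj₁ ¬gx) (inj₁ ¬gy) e = ⟨$⟩ʳ-injective σ (trans (sym (f-g ¬gx)) (trans e (f-g ¬gy)))
    f-injective (inj₁ ¬gx) (inj₂ ¬hy) e = contradiction (trans (sym (f-g ¬gx)) (trans e (f-h ¬hy)))
      (disjoint-images ¬gx ¬hy)
    f-injective (inj₂ ¬hx) (inj₁ ¬gy) e = contradiction (trans (sym (f-g ¬gy)) (trans (sym e) (f-h ¬hx)))
      (disjoint-images ¬gy ¬hx)
    f-injective (inj₂ ¬hx) (inj₂ ¬hy) e = ⟨$⟩ʳ-injective τ (trans (sym (f-h ¬hx)) (trans e (f-h ¬hy)))
    extension : ∃[ ρ ] (∀ {x} → P x → ρ ⟨$⟩ʳ x ≡ f x)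
    extension = partialInjection-extends P? f f-injective
    ρ : Permutation′ n
    ρ = proj₁ extension
    agree : ∀ {x} → P x → ρ ⟨$⟩ʳ x ≡ f x
    agree = proj₂ extension

  -- As long as `g` and `h` share a vertex `x`, their sum has fewer than `n` non-isolated vertices,
  -- so some `y` is isolated in it. Transposing `x` and `y` in `g` makes `y` occupied, while `x`
  -- stays occupied through `h`. The number of occupied vertices grows and is bounded by `n`, so the
  -- process ends.
  separate : (g h : Multigraph n) → nonIsolatedVertices g + nonIsolatedVertices h ≤ n →
    ∃[ σ ] VertexDisjoint (σ • g) h
  separate g h bound = go g bound (<-wellFounded _)
    where
    go : ∀ g → nonIsolatedVertices g + nonIsolatedVertices h ≤ n →
      Acc _<_ (n ∸ nonIsolatedVertices (g +ᵍ h)) → ∃[ σ ] VertexDisjoint (σ • g) h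
    go g bound (acc rec) with vertexDisjoint? g h
    ... | inj₁ disj = idₚ , disj
    ... | inj₂ (x , ¬gx , ¬hx) =
      let σ , disj = go g′ bound′ (rec (∸-monoʳ-< more (nonIsolatedVertices≤n (g′ +ᵍ h))))
      in τ ∘ₚ σ , disj
      where
      free : ∃[ y ] Isolated (g +ᵍ h) y
      free = ∃-isolated (g +ᵍ h) (<-≤-trans (nonIsolatedVertices-+-< g h ¬gx ¬hx) bound)
      y : Fin n
      y = proj₁ free
      τ : Permutation′ n
      τ = transpose x y
      g′ : Multigraph n
      g′ = τ • g
      bound′ : nonIsolatedVertices g′ + nonIsolatedVertices h ≤ n
      bound′ = subst (λ v → v + nonIsolatedVertices h ≤ n) (sym (nonIsolatedVertices-• τ g)) bound
      y-occupied : ¬ Isolated (g′ +ᵍ h) y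
      y-occupied iso′ = ¬isolated-•-≈ g g′ τ (λ i j → refl) ¬gx
        (subst (Isolated g′) (sym (transpose-left x y)) (isolated-+ˡ g′ h iso′))
      still-occupied : ∀ {z} → Isolated (g′ +ᵍ h) z → Isolated (g +ᵍ h) z
      still-occupied {z} iso′ = case z ≟ᶠ x of λ where
        (yes refl) → contradiction (isolated-+ʳ g′ h iso′) ¬hx
        (no z≢x)   → case z ≟ᶠ y of λ where
          (yes refl) → proj₂ free
          (no z≢y)   → isolated-+ g h
            (subst (Isolated g) (transpose-other y x z≢y z≢x) (isolated-•⁻ τ g {z} (isolated-+ˡ g′ h iso′)))
            (isolated-+ʳ g′ h iso′)
      more : nonIsolatedVertices (g +ᵍ h) < nonIsolatedVertices (g′ +ᵍ h)
      more = nonIsolatedVertices-mono-< (g +ᵍ h) (g′ +ᵍ h) still-occupied (proj₂ free) y-occupied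

  -- Sums of lists of graphs

  ⨁ : List (Multigraph n) → Multigraph n
  ⨁ = foldr _+ᵍ_ ∅ᵍ

  -- Comparing each graph with the sum of the later ones amounts to comparing it with each of them,
  -- since a vertex is isolated in a sum exactly when it is isolated in all summands. This form
  -- follows the recursion of `⨁`.
  PairwiseDisjoint : List (Multigraph n) → Set
  PairwiseDisjoint []       = ⊤
  PairwiseDisjoint (g ∷ gs) = VertexDisjoint g (⨁ gs) × PairwiseDisjoint gs

  total-≅ : (f : Multigraph n → ℕ) → (∀ {g h} → g ≅ h → f g ≡ f h) →
    ∀ {gs hs} → Pointwise _≅_ gs hs → total (map f gs) ≡ total (map f hs)
  total-≅ f f-cong []       = refl
  total-≅ f f-cong (i ∷ is) = cong₂ _+_ (f-cong i) (total-≅ f f-cong is)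

  -- The double sum does not compute for a variable `n`; but `∅ᵍ +ᵍ ∅ᵍ` has the multiplicities of
  -- `∅ᵍ`, so additivity and cancellation apply.
  edges-∅ : edges {n} ∅ᵍ ≡ 0
  edges-∅ = +-cancelˡ-≡ (edges {n} ∅ᵍ) (edges {n} ∅ᵍ) 0
    (trans (sym (edges-+ (∅ᵍ {n}) ∅ᵍ)) (sym (+-identityʳ _)))

  edges-⨁ : ∀ gs → edges (⨁ gs) ≡ total (map edges gs)
  edges-⨁ []       = edges-∅
  edges-⨁ (g ∷ gs) = trans (edges-+ g (⨁ gs)) (cong (edges g +_) (edges-⨁ gs))

  nonIsolatedVertices-∅ : nonIsolatedVertices {n} ∅ᵍ ≡ 0
  nonIsolatedVertices-∅ = +-cancelˡ-≡ v v 0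
    (trans (sym (nonIsolatedVertices-+-disjoint (∅ᵍ {n}) ∅ᵍ λ i → inj₁ λ j → refl)) (sym (+-identityʳ v)))
    where
    v : ℕ
    v = nonIsolatedVertices {n} ∅ᵍ

  nonIsolatedVertices-⨁ : ∀ gs → PairwiseDisjoint gs →
    nonIsolatedVertices (⨁ gs) ≡ total (map nonIsolatedVertices gs)
  nonIsolatedVertices-⨁ []       _             = nonIsolatedVertices-∅
  nonIsolatedVertices-⨁ (g ∷ gs) (disj , disjs) = trans
    (nonIsolatedVertices-+-disjoint g (⨁ gs) disj)
    (cong (nonIsolatedVertices g +_) (nonIsolatedVertices-⨁ gs disjs))

  nonIsolatedVertices-⨁-≤ : ∀ gs → nonIsolatedVertices (⨁ gs) ≤ total (map nonIsolatedVertices gs)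
  nonIsolatedVertices-⨁-≤ []       = ≤-reflexive nonIsolatedVertices-∅
  nonIsolatedVertices-⨁-≤ (g ∷ gs) = ≤-trans (nonIsolatedVertices-+-≤ g (⨁ gs))
    (+-monoʳ-≤ (nonIsolatedVertices g) (nonIsolatedVertices-⨁-≤ gs))

  -- A collision at one addition loses a vertex, and later additions cannot make up for it because
  -- the count is subadditive.
  disjoint-or-fewer-vertices : ∀ gs →
    PairwiseDisjoint gs ⊎ nonIsolatedVertices (⨁ gs) < total (map nonIsolatedVertices gs)
  disjoint-or-fewer-vertices [] = inj₁ tt
  disjoint-or-fewer-vertices (g ∷ gs) with disjoint-or-fewer-vertices gs | vertexDisjoint? g (⨁ gs)
  ... | inj₁ disjs | inj₁ disj = inj₁ (disj , disjs)
  ... | inj₁ _     | inj₂ (i , ¬gi , ¬gsi) = inj₂ (<-≤-trans (nonIsolatedVertices-+-< g (⨁ gs) ¬gi ¬gsi)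
                                                   (+-monoʳ-≤ (nonIsolatedVertices g) (nonIsolatedVertices-⨁-≤ gs)))
  ... | inj₂ fewer | _ = inj₂ (≤-<-trans (nonIsolatedVertices-+-≤ g (⨁ gs))
                                 (+-monoʳ-< (nonIsolatedVertices g) fewer))

  ⨁-≅ : ∀ {gs hs} → PairwiseDisjoint gs → PairwiseDisjoint hs → Pointwise _≅_ gs hs → ⨁ gs ≅ ⨁ hs
  ⨁-≅ _ _ [] = ≅-refl
  ⨁-≅ {g ∷ gs} {h ∷ hs} (gd , gds) (hd , hds) (i ∷ is) =
    +ᵍ-≅ g (⨁ gs) h (⨁ hs) gd hd i (⨁-≅ gds hds is)

  -- The copies of the tail, once disjoint, occupy exactly the sum of their vertex counts, so the
  -- bound leaves the room that `separate` requires for the head.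
  disjoint-copies : ∀ gs → total (map nonIsolatedVertices gs) ≤ n →
    ∃[ hs ] Pointwise _≅_ gs hs × PairwiseDisjoint hs
  disjoint-copies []       _     = [] , [] , tt
  disjoint-copies (g ∷ gs) bound =
    let hs , isos , disjs = disjoint-copies gs (m+n≤o⇒n≤o (nonIsolatedVertices g) bound)
        same = trans (nonIsolatedVertices-⨁ hs disjs) (sym (total-≅ nonIsolatedVertices nonIsolatedVertices-≅ isos))
        σ , disj = separate g (⨁ hs) (subst (λ v → nonIsolatedVertices g + v ≤ n) (sym same) bound)
    in (σ • g) ∷ hs , •-≅ σ g ∷ isos , disj , disjs

  ⨁-• : ∀ (σ : Permutation′ n) gs → σ • ⨁ gs ≈ᵍ ⨁ (map (σ •_) gs)
  ⨁-• σ []       i j = refl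
  ⨁-• σ (g ∷ gs) i j = cong (mult g (σ ⟨$⟩ˡ i) (σ ⟨$⟩ˡ j) +_) (⨁-• σ gs i j)

  map-•-≅ : ∀ (σ : Permutation′ n) gs → Pointwise _≅_ gs (map (σ •_) gs)
  map-•-≅ σ []       = []
  map-•-≅ σ (g ∷ gs) = •-≅ σ g ∷ map-•-≅ σ gs

  disjoint-• : ∀ (σ : Permutation′ n) gs → PairwiseDisjoint gs → PairwiseDisjoint (map (σ •_) gs)
  disjoint-• σ []       _              = tt
  disjoint-• σ (g ∷ gs) (disj , disjs) = disj′ , disjoint-• σ gs disjs
    where
    disj′ : VertexDisjoint (σ • g) (⨁ (map (σ •_) gs))
    disj′ i with disj (σ ⟨$⟩ˡ i)
    ... | inj₁ gi  = inj₁ (isolated-•⁺ σ g {i} gi)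
    ... | inj₂ gsi = inj₂ (isolated-resp (σ • ⨁ gs) (⨁ (map (σ •_) gs)) (⨁-• σ gs) (isolated-•⁺ σ (⨁ gs) {i} gsi))

  quasiConnected-all-≅ : {gs hs : List (Multigraph n)} → Pointwise _≅_ gs hs →
    All QuasiConnected gs → All QuasiConnected hs
  quasiConnected-all-≅ []       []         = []
  quasiConnected-all-≅ (i ∷ is) (qc ∷ qcs) = quasiConnected-≅ i qc ∷ quasiConnected-all-≅ is qcs

-- Connected components

module _ {n : ℕ} where

  restrict : Subset n → Multigraph n → Multigraph n
  restrict S g .mult i j = if does (i ∈? S) ∧ does (j ∈? S) then mult g i j else 0
  restrict S g .mult-sym i j =
    cong₂ (if_then_else 0) (∧-comm (does (i ∈? S)) (does (j ∈? S))) (mult-sym g i j)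
  restrict S g .mult-irrefl i =
    trans (cong (if b then_else 0) (mult-irrefl g i)) (if-eta b)
    where
    b : Bool
    b = does (i ∈? S) ∧ does (i ∈? S)

  restrict-inside : ∀ (S : Subset n) g {i j} → i ∈ˢ S → j ∈ˢ S → mult (restrict S g) i j ≡ mult g i j
  restrict-inside S g {i} {j} i∈S j∈S = cong₂ (λ a b → if a ∧ b then mult g i j else 0)
    (dec-true (i ∈? S) i∈S) (dec-true (j ∈? S) j∈S)

  restrict-outside : ∀ (S : Subset n) g {i} → i ∉ˢ S → Isolated (restrict S g) i
  restrict-outside S g {i} i∉S j = cong (λ a → if a ∧ does (j ∈? S) then mult g i j else 0)
    (dec-false (i ∈? S) i∉S)

  restrict-isolated : ∀ (S : Subset n) g {i} → Isolated g i → Isolated (restrict S g) i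
  restrict-isolated S g {i} gi j =
    trans (cong (if b then_else 0) (gi j)) (if-eta b)
    where
    b : Bool
    b = does (i ∈? S) ∧ does (j ∈? S)

  -- These sets are the unions of connected components.
  Closed : Multigraph n → Subset n → Set
  Closed g S = ∀ {i j} → i ∈ˢ S → Adjacent g i j → j ∈ˢ S

  module _ (g : Multigraph n) (S : Subset n) (closed : Closed g S) where

    restrict-∁-disjoint : VertexDisjoint (restrict S g) (restrict (∁ S) g)
    restrict-∁-disjoint i = case i ∈? S of λ where
      (yes i∈S) → inj₂ (restrict-outside (∁ S) g (λ i∈∁S → x∈∁p⇒x∉p i∈∁S i∈S))
      (no  i∉S) → inj₁ (restrict-outside S g i∉S)

    private
      crossing : ∀ {i j} → i ∈ˢ S → j ∉ˢ S → mult g i j ≡ 0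
      crossing {i} {j} i∈S j∉S = decidable-stable (mult g i j ≟ 0) λ adj → j∉S (closed i∈S adj)

      split-inside : ∀ {i} j → i ∈ˢ S → mult (restrict S g) i j ≡ mult g i j
      split-inside {i} j i∈S = case j ∈? S of λ where
        (yes j∈S) → restrict-inside S g i∈S j∈S
        (no  j∉S) → trans (mult-sym (restrict S g) i j) (trans (restrict-outside S g j∉S i) (sym (crossing i∈S j∉S)))

      split-outside : ∀ {i} j → i ∉ˢ S → mult (restrict (∁ S) g) i j ≡ mult g i j
      split-outside {i} j i∉S = case j ∈? S of λ where
        (yes j∈S) → trans (mult-sym (restrict (∁ S) g) i j)
          (trans (restrict-outside (∁ S) g (λ j∈∁S → x∈∁p⇒x∉p j∈∁S j∈S) i)
            (trans (sym (crossing j∈S i∉S)) (mult-sym g j i)))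
        (no  j∉S) → restrict-inside (∁ S) g (x∉p⇒x∈∁p i∉S) (x∉p⇒x∈∁p j∉S)

    -- No edge joins a closed set to its complement, so every edge survives in one of the two
    -- restrictions.
    restrict-split : restrict S g +ᵍ restrict (∁ S) g ≈ᵍ g
    restrict-split i j = case i ∈? S of λ where
      (yes i∈S) → trans (cong₂ _+_ (split-inside j i∈S) (restrict-outside (∁ S) g (λ i∈∁S → x∈∁p⇒x∉p i∈∁S i∈S) j))
        (+-identityʳ _)
      (no  i∉S) → cong₂ _+_ (restrict-outside S g i∉S j) (split-outside j i∉S)

    connected-restrict : ∀ {i j} → i ∈ˢ S → Connected g i j → Connected (restrict S g) i j
    connected-restrict i∈S ε = ε
    connected-restrict i∈S (adj ◅ path) =
      (adj ∘ trans (sym (restrict-inside S g i∈S (closed i∈S adj)))) ◅ connected-restrict (closed i∈S adj) path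

  connected-sym : (g : Multigraph n) → ∀ {i j} → Connected g i j → Connected g j i
  connected-sym g = reverse (adjacent-sym g)

  -- Saturation starting from `⁅ x ⁆`: while an edge leaves the set, its outer end is added. Every
  -- added vertex comes with a path from `x`, the finite vertex set bounds the growth, and a set
  -- that no edge leaves is closed.
  component : ∀ g (x : Fin n) → ∃[ S ] x ∈ˢ S × (∀ {y} → y ∈ˢ S → Connected g x y) × Closed g S
  component g x = grow ⁅ x ⁆ (x∈⁅x⁆ x)
    (λ y∈ → subst (Connected g x) (sym (x∈⁅y⁆⇒x≡y x y∈)) ε) (⊃-wellFounded _)
    where
    grow : ∀ S → x ∈ˢ S → (∀ {y} → y ∈ˢ S → Connected g x y) → Acc _⊃_ S →
      ∃[ S′ ] x ∈ˢ S′ × (∀ {y} → y ∈ˢ S′ → Connected g x y) × Closed g S′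
    grow S x∈S reach (acc rec)
      with any? (λ y → any? λ z → (y ∈? S) ×-dec (¬? (z ∈? S) ×-dec ¬? (mult g y z ≟ 0)))
    ... | no ¬p = S , x∈S , reach , λ {y} {z} y∈S adj →
      decidable-stable (z ∈? S) λ z∉S → ¬p (y , z , y∈S , z∉S , adj)
    ... | yes (y , z , y∈S , z∉S , adj) = grow (S ∪ ⁅ z ⁆) (p⊆p∪q ⁅ z ⁆ x∈S) reach′
      (rec (p⊆p∪q ⁅ z ⁆ , z , q⊆p∪q S ⁅ z ⁆ (x∈⁅x⁆ z) , z∉S))
      where
      reach′ : ∀ {w} → w ∈ˢ S ∪ ⁅ z ⁆ → Connected g x w
      reach′ w∈ with x∈p∪q⁻ S ⁅ z ⁆ w∈
      ... | inj₁ w∈S = reach w∈S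
      ... | inj₂ w∈z = subst (Connected g x) (sym (x∈⁅y⁆⇒x≡y z w∈z)) (reach y∈S ◅◅ adj ◅ ε)

  inNontrivial⇒¬isolated : (g : Multigraph n) → ∀ {i} → InNontrivialComponent g i → ¬ Isolated g i
  inNontrivial⇒¬isolated g (j , j≢i , ε) = contradiction refl j≢i
  inNontrivial⇒¬isolated g (j , j≢i , adj ◅ _) = adjacent⇒¬isolated g adj

  ¬isolated⇒inNontrivial : (g : Multigraph n) → ∀ {i} → ¬ Isolated g i → InNontrivialComponent g i
  ¬isolated⇒inNontrivial g {i} ¬gi with ¬isolated⇒adjacent g ¬gi
  ... | j , adj = j , (λ { refl → adj (mult-irrefl g i) }) , adj ◅ ε

  -- The component `S` of a non-isolated vertex `x` is split off, and `x` becomes isolated in the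
  -- remainder, which makes the recursion descend. The piece is quasi-connected because its
  -- non-isolated vertices lie in `S`, and the paths joining them to `x` never leave the closed set
  -- `S`.
  decompose : ∀ g → ∃[ cs ] All QuasiConnected cs × PairwiseDisjoint cs × ⨁ cs ≈ᵍ g
  decompose g = go g (<-wellFounded _)
    where
    go : ∀ g → Acc _<_ (nonIsolatedVertices g) → ∃[ cs ] All QuasiConnected cs × PairwiseDisjoint cs × ⨁ cs ≈ᵍ g
    go g (acc rec) with any? (λ i → ¬? (isolated? g i))
    ... | no ¬p = [] , [] , tt , λ i j →
      sym (decidable-stable (mult g i j ≟ 0) (λ adj → ¬p (i , adjacent⇒¬isolated g adj)))
    ... | yes (x , ¬gx) with component g x
    ...   | S , x∈S , reach , closed with go (restrict (∁ S) g) (rec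
              (nonIsolatedVertices-mono-< (restrict (∁ S) g) g (restrict-isolated (∁ S) g)
                (restrict-outside (∁ S) g (λ x∈∁S → x∈∁p⇒x∉p x∈∁S x∈S)) ¬gx))
    ...     | cs , qcs , disjs , sum≈ = restrict S g ∷ cs , qc ∷ qcs , (disj , disjs) , λ i j →
      trans (cong (mult (restrict S g) i j +_) (sum≈ i j)) (restrict-split g S closed i j)
      where
      inside : ∀ {i} → InNontrivialComponent (restrict S g) i → i ∈ˢ S
      inside {i} nt = decidable-stable (i ∈? S) λ i∉S →
        inNontrivial⇒¬isolated (restrict S g) nt (restrict-outside S g i∉S)
      from-x : ∀ {i} → InNontrivialComponent (restrict S g) i → Connected (restrict S g) x i
      from-x nt = connected-restrict g S closed x∈S (reach (inside nt))
      qc : QuasiConnected (restrict S g)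
      qc i j nti ntj = connected-sym (restrict S g) (from-x nti) ◅◅ from-x ntj
      disj : VertexDisjoint (restrict S g) (⨁ cs)
      disj i with restrict-∁-disjoint g S closed i
      ... | inj₁ gi = inj₁ gi
      ... | inj₂ gi = inj₂ (isolated-resp (restrict (∁ S) g) (⨁ cs) (λ i j → sym (sum≈ i j)) gi)

-- Uniqueness of the decomposition into components.  Phrasing it through a multiplicative function F of the
-- components avoids permutations of lists.

module _ {n : ℕ} where

  -- Every edge of `g` can be reached from `x` along edges of `g`. Each step is an edge of `h +ᵍ s`
  -- that starts at a vertex of `h`, where `s` is isolated, so it is an edge of `h` and the path
  -- stays among the vertices of `h`. At its end both `r` and `s` contribute nothing.
  quasiConnected-⊆ : (g r h s : Multigraph n) → QuasiConnected g → VertexDisjoint g r → VertexDisjoint h s →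
    g +ᵍ r ≈ᵍ h +ᵍ s → ∀ {x} → ¬ Isolated g x → ¬ Isolated h x →
    ∀ {i j} → Adjacent g i j → mult g i j ≡ mult h i j
  quasiConnected-⊆ g r h s qc disj disj′ eq {x} ¬gx ¬hx {i} {j} adj = begin
    mult g i j               ≡⟨ +-identityʳ _ ⟨
    mult g i j + 0           ≡⟨ cong (mult g i j +_) (other g r disj (adjacent⇒¬isolated g adj) j) ⟨
    mult (g +ᵍ r) i j        ≡⟨ eq i j ⟩
    mult (h +ᵍ s) i j        ≡⟨ cong (mult h i j +_) (other h s disj′ (stays ¬hx path) j) ⟩
    mult h i j + 0           ≡⟨ +-identityʳ _ ⟩
    mult h i j               ∎
    where
    open ≡-Reasoning
    other : (a b : Multigraph n) → VertexDisjoint a b → ∀ {y} → ¬ Isolated a y → Isolated b y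
    other a b ab {y} ¬ay = [ (λ ay → contradiction ay ¬ay) , id ]′ (ab y)
    stays : ∀ {y z} → ¬ Isolated h y → Connected g y z → ¬ Isolated h z
    stays ¬hy ε = ¬hy
    stays {y} ¬hy (_◅_ {j = w} yw path) = stays (adjacent⇒¬isolated h (adjacent-sym h yw′)) path
      where
      yw′ : Adjacent h y w
      yw′ hyw≡0 = yw (m+n≡0⇒m≡0 (mult g y w) (trans (eq y w) (cong₂ _+_ hyw≡0 (other h s disj′ ¬hy w))))
    path : Connected g x i
    path = qc x i (¬isolated⇒inNontrivial g ¬gx) (¬isolated⇒inNontrivial g (adjacent⇒¬isolated g adj))

  sharedVertex⇒≈ᵍ : (g r h s : Multigraph n) → QuasiConnected g → QuasiConnected h →
    VertexDisjoint g r → VertexDisjoint h s → g +ᵍ r ≈ᵍ h +ᵍ s →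
    ∀ {x} → ¬ Isolated g x → ¬ Isolated h x → g ≈ᵍ h
  sharedVertex⇒≈ᵍ g r h s qcg qch disj disj′ eq ¬gx ¬hx i j with mult g i j ≟ 0 | mult h i j ≟ 0
  ... | yes g≡0 | yes h≡0 = trans g≡0 (sym h≡0)
  ... | no adj  | _       = quasiConnected-⊆ g r h s qcg disj disj′ eq ¬gx ¬hx adj
  ... | yes _   | no adj  = sym (quasiConnected-⊆ h s g r qch disj′ disj (λ i j → sym (eq i j)) ¬hx ¬gx adj)

module _ {n : ℕ} {c ℓ} (M : CommutativeMonoid c ℓ) (F : Multigraph n → CommutativeMonoid.Carrier M) where

  private
    module M = CommutativeMonoid M

  ∏ : List (Multigraph n) → M.Carrier
  ∏ gs = foldr M._∙_ M.ε (map F gs)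

  module _ (F-cong : ∀ g h → g ≈ᵍ h → F g M.≈ F h) (F-∅ : F ∅ᵍ M.≈ M.ε) where

    private
      -- The list `hs` with the entry `k` that contains `x` brought to the front. The rearrangement
      -- is recorded only through its effect on `⨁` and `∏`.
      record Extracted (x : Fin n) (hs : List (Multigraph n)) : Set ℓ where
        field
          {k}      : Multigraph n
          {ks}     : List (Multigraph n)
          k-qc     : QuasiConnected k
          ks-qc    : All QuasiConnected ks
          disj     : VertexDisjoint k (⨁ ks)
          disjs    : PairwiseDisjoint ks
          ¬kx      : ¬ Isolated k x
          ⨁-split  : ⨁ hs ≈ᵍ k +ᵍ ⨁ ks
          ∏-split  : ∏ hs M.≈ F k M.∙ ∏ ks

      extract : ∀ {x} hs → All QuasiConnected hs → PairwiseDisjoint hs → ¬ Isolated (⨁ hs) x → Extracted x hs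
      extract [] _ _ ¬hx = contradiction (λ j → refl) ¬hx
      extract {x} (h ∷ hs) (qc ∷ qcs) (disj , disjs) ¬x with isolated? h x
      ... | no ¬hx = record
        { k-qc = qc ; ks-qc = qcs ; disj = disj ; disjs = disjs ; ¬kx = ¬hx
        ; ⨁-split = λ i j → refl ; ∏-split = M.refl }
      ... | yes hx = record
        { k = E.k ; ks = h ∷ E.ks ; k-qc = E.k-qc ; ks-qc = qc ∷ E.ks-qc
        ; disj = k-disj ; disjs = h-disj , E.disjs ; ¬kx = E.¬kx
        ; ⨁-split = λ i j → trans (cong (mult h i j +_) (E.⨁-split i j))
            (swap (mult h i j) (mult E.k i j) (mult (⨁ E.ks) i j))
        ; ∏-split = M.trans (M.∙-congˡ E.∏-split) (x∙yz≈y∙xz (F h) (F E.k) (∏ E.ks)) }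
        where
        module E = Extracted (extract {x} hs qcs disjs (¬x ∘ isolated-+ h (⨁ hs) hx))
        open CommutativeSemigroupProperties M.commutativeSemigroup using (x∙yz≈y∙xz)
        swap : ∀ a b c → a + (b + c) ≡ b + (a + c)
        swap a b c = trans (sym (+-assoc a b c)) (trans (cong (_+ c) (+-comm a b)) (+-assoc b a c))
        split : ∀ {i} → Isolated (⨁ hs) i → Isolated (E.k +ᵍ ⨁ E.ks) i
        split = isolated-resp (⨁ hs) (E.k +ᵍ ⨁ E.ks) E.⨁-split
        k-disj : VertexDisjoint E.k (⨁ (h ∷ E.ks))
        k-disj i with E.disj i | disj i
        ... | inj₁ ki  | _        = inj₁ ki
        ... | inj₂ _   | inj₂ hsi = inj₁ (isolated-+ˡ E.k (⨁ E.ks) (split hsi))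
        ... | inj₂ ksi | inj₁ hi  = inj₂ (isolated-+ h (⨁ E.ks) hi ksi)
        h-disj : VertexDisjoint h (⨁ E.ks)
        h-disj i with disj i
        ... | inj₁ hi  = inj₁ hi
        ... | inj₂ hsi = inj₂ (isolated-+ʳ E.k (⨁ E.ks) (split hsi))

    ∏-empty : ∀ hs → ⨁ hs ≈ᵍ ∅ᵍ → ∏ hs M.≈ M.ε
    ∏-empty []       _  = M.refl
    ∏-empty (h ∷ hs) eq = M.trans
      (M.∙-cong (M.trans (F-cong h ∅ᵍ λ i j → m+n≡0⇒m≡0 (mult h i j) (eq i j)) F-∅)
                (∏-empty hs λ i j → m+n≡0⇒n≡0 (mult h i j) (eq i j)))
      (M.identityˡ M.ε)

    -- Empty graphs may occur in either list, and `F-∅` makes them invisible. If `g` has a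
    -- non-isolated vertex `x`, the entry of `hs` containing `x` must equal `g`; both are cancelled
    -- and the recursion continues with the remainders.
    ∏-⨁-unique : ∀ gs hs → All QuasiConnected gs → All QuasiConnected hs →
      PairwiseDisjoint gs → PairwiseDisjoint hs → ⨁ gs ≈ᵍ ⨁ hs → ∏ gs M.≈ ∏ hs
    ∏-⨁-unique []       hs _ _ _ _ eq = M.sym (∏-empty hs λ i j → sym (eq i j))
    ∏-⨁-unique (g ∷ gs) hs (gqc ∷ gqcs) hqcs (gdisj , gdisjs) hdisjs eq
      with any? (λ i → ¬? (isolated? g i))
    ... | no ¬p = M.trans (M.∙-congʳ (M.trans (F-cong g ∅ᵍ g≈∅) F-∅)) (M.trans (M.identityˡ (∏ gs))
      (∏-⨁-unique gs hs gqcs hqcs gdisjs hdisjs λ i j →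
        trans (cong (_+ mult (⨁ gs) i j) (sym (g≈∅ i j))) (eq i j)))
      where
      g≈∅ : g ≈ᵍ ∅ᵍ
      g≈∅ i j = decidable-stable (isolated? g i) (λ ¬gi → ¬p (i , ¬gi)) j
    ... | yes (x , ¬gx) = M.trans
      (M.∙-cong (F-cong g E.k g≈k) (∏-⨁-unique gs E.ks gqcs E.ks-qc gdisjs E.disjs λ i j →
        +-cancelˡ-≡ (mult g i j) _ _ (trans (eq′ i j) (cong (_+ mult (⨁ E.ks) i j) (sym (g≈k i j))))))
      (M.sym E.∏-split)
      where
      module E = Extracted (extract {x} hs hqcs hdisjs λ hsx →
        ¬gx (isolated-+ˡ g (⨁ gs) (isolated-resp (⨁ hs) (g +ᵍ ⨁ gs) (λ i j → sym (eq i j)) hsx)))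
      eq′ : g +ᵍ ⨁ gs ≈ᵍ E.k +ᵍ ⨁ E.ks
      eq′ i j = trans (eq i j) (E.⨁-split i j)
      g≈k : g ≈ᵍ E.k
      g≈k = sharedVertex⇒≈ᵍ g (⨁ gs) E.k (⨁ E.ks) gqc E.k-qc gdisj E.disj eq′ ¬gx E.¬kx

-- Orbits

-- Removing `zero` from `σ` leaves a smaller permutation to look up. Agreement is pointwise, as the
-- listed permutation need not be identical to `σ` as a record.
∈-allPermutations : ∀ n (σ : Permutation′ n) → ∃[ τ ] τ ∈ allPermutations n × (∀ i → τ ⟨$⟩ʳ i ≡ σ ⟨$⟩ʳ i)
∈-allPermutations zero    σ = idₚ , here refl , λ ()
∈-allPermutations (suc n) σ =
  let τ , τ∈ , τ≗ = ∈-allPermutations n (remove zero σ)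
      j = σ ⟨$⟩ʳ zero
  in insert zero j τ
   , ∈-concatMap⁺ (λ j → map (insert zero j) (allPermutations n)) (lose (∈-allFin j) (∈-map⁺ (insert zero j) τ∈))
   , λ { zero    → refl
       ; (suc k) → trans (insert-punchIn zero j τ k)
           (trans (cong (punchIn j) (τ≗ k))
             (trans (sym (insert-punchIn zero j (remove zero σ) k)) (insert-remove zero σ (suc k)))) }

module _ {n : ℕ} where

  ≈ᵍ-decSetoid : DecSetoid 0ℓ 0ℓ
  ≈ᵍ-decSetoid = record
    { Carrier = Multigraph n
    ; _≈_ = _≈ᵍ_
    ; isDecEquivalence = record
      { isEquivalence = record
        { refl = λ i j → refl
        ; sym = λ g≈h i j → sym (g≈h i j)
        ; trans = λ g≈h h≈k i j → trans (g≈h i j) (h≈k i j)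
        }
      ; _≟_ = _≟ᵍ_
      }
    }

  -- Reduces the search for an isomorphism to a finite list, which makes `_≅_` decidable.
  ≅⇒listed : {g h : Multigraph n} → g ≅ h → Any.Any (λ σ → σ • g ≈ᵍ h) (allPermutations n)
  ≅⇒listed {g} {h} (iso σ eq) =
    let τ , τ∈ , τ≗ = ∈-allPermutations n σ
    in lose τ∈ (•-≈-intro g h τ λ i j → trans (cong₂ (mult h) (τ≗ i) (τ≗ j)) (•-≈-elim g h σ eq i j))

  infix 4 _≅?_

  _≅?_ : (g h : Multigraph n) → Dec (g ≅ h)
  g ≅? h = map′ (λ a → let σ , eq = Any.satisfied a in iso σ eq) ≅⇒listed
    (Any.any? (λ σ → σ • g ≟ᵍ h) (allPermutations n))

  ≅-decSetoid : DecSetoid 0ℓ 0ℓ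
  ≅-decSetoid = record
    { Carrier = Multigraph n
    ; _≈_ = _≅_
    ; isDecEquivalence = record
      { isEquivalence = record { refl = ≅-refl ; sym = ≅-sym ; trans = ≅-trans }
      ; _≟_ = _≅?_
      }
    }

  module _ (g : Multigraph n) where

    ∈-orbit⁺ : ∀ {h} → g ≅ h → SetoidMembership._∈_ (DecSetoid.setoid ≈ᵍ-decSetoid) h (orbit g)
    ∈-orbit⁺ {h} g≅h = ∈-deduplicate⁺ (DecSetoid.setoid ≈ᵍ-decSetoid) _≟ᵍ_
      (λ z≈y x≈y i j → trans (x≈y i j) (sym (z≈y i j))) {z = h}
      (Anyₚ.map⁺ (Any.map (λ eq i j → sym (eq i j)) (≅⇒listed g≅h)))

    ∈-orbit⁻ : All (g ≅_) (orbit g)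
    ∈-orbit⁻ = Allₚ.deduplicate⁺ _≟ᵍ_ (Allₚ.map⁺ (All.tabulate λ {σ} _ → •-≅ σ g))

    orbit-unique : UniqueSetoid.Unique (DecSetoid.setoid ≈ᵍ-decSetoid) (orbit g)
    orbit-unique = deduplicate-! ≈ᵍ-decSetoid (map (_• g) (allPermutations n))

-- Polynomials

module PolynomialAlgebra {c ℓ₁ ℓ₂} (K : HeytingField c ℓ₁ ℓ₂) (n : ℕ) where

  open InvariantRing K n

  K-ring : CommutativeRing c ℓ₁
  K-ring = HeytingCommutativeRing.commutativeRing (HeytingField.heytingCommutativeRing K)

  open CommutativeRing K-ring public
    using (Carrier; _≈_; 0#; 1#; -_; +-cong; +-congˡ; +-congʳ; -‿inverseʳ; -‿cong;
           *-cong; *-congˡ; *-congʳ; *-comm; *-identityˡ; *-identityʳ; zeroˡ; zeroʳ; distribˡ; distribʳ)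
    renaming (_+_ to _+ᴷ_; _*_ to _*ᴷ_; refl to ≈-refl; sym to ≈-sym; trans to ≈-trans; reflexive to ≈-reflexive;
              setoid to K-setoid; +-assoc to +ᴷ-assoc; +-comm to +ᴷ-comm; +-identityˡ to +ᴷ-identityˡ;
              +-identityʳ to +ᴷ-identityʳ; *-assoc to *ᴷ-assoc;
              +-commutativeMonoid to +ᴷ-commutativeMonoid;
              *-commutativeSemigroup to *ᴷ-commutativeSemigroup)

  private
    open module +ᴷ-Properties = CommutativeSemigroupProperties
      (CommutativeMonoid.commutativeSemigroup +ᴷ-commutativeMonoid) using (interchange)
    open module *ᴷ-Properties = CommutativeSemigroupProperties *ᴷ-commutativeSemigroup using (x∙yz≈y∙xz)

  -- Finite sums in `K`

  module _ {a} {A : Set a} where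

    ∑ : List A → (A → Carrier) → Carrier
    ∑ []       f = 0#
    ∑ (x ∷ xs) f = f x +ᴷ ∑ xs f

    ∑-congᴬ : ∀ {xs} {f g : A → Carrier} → All (λ x → f x ≈ g x) xs → ∑ xs f ≈ ∑ xs g
    ∑-congᴬ []         = ≈-refl
    ∑-congᴬ (eq ∷ eqs) = +-cong eq (∑-congᴬ eqs)

    ∑-cong : ∀ xs {f g : A → Carrier} → (∀ x → f x ≈ g x) → ∑ xs f ≈ ∑ xs g
    ∑-cong xs eq = ∑-congᴬ (All.universal eq xs)

    ∑-zero : ∀ {xs} {f : A → Carrier} → All (λ x → f x ≈ 0#) xs → ∑ xs f ≈ 0#
    ∑-zero []         = ≈-refl
    ∑-zero (eq ∷ eqs) = ≈-trans (+-cong eq (∑-zero eqs)) (+ᴷ-identityˡ 0#)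

    ∑-++ : ∀ xs ys (f : A → Carrier) → ∑ (xs ++ ys) f ≈ ∑ xs f +ᴷ ∑ ys f
    ∑-++ []       ys f = ≈-sym (+ᴷ-identityˡ _)
    ∑-++ (x ∷ xs) ys f = ≈-trans (+-congˡ (∑-++ xs ys f)) (≈-sym (+ᴷ-assoc _ _ _))

    ∑-+ : ∀ xs (f g : A → Carrier) → ∑ xs (λ x → f x +ᴷ g x) ≈ ∑ xs f +ᴷ ∑ xs g
    ∑-+ []       f g = ≈-sym (+ᴷ-identityˡ 0#)
    ∑-+ (x ∷ xs) f g = ≈-trans (+-congˡ (∑-+ xs f g)) (interchange (f x) (g x) (∑ xs f) (∑ xs g))

    ∑-* : ∀ a xs (f : A → Carrier) → ∑ xs (λ x → a *ᴷ f x) ≈ a *ᴷ ∑ xs f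
    ∑-* a []       f = ≈-sym (zeroʳ a)
    ∑-* a (x ∷ xs) f = ≈-trans (+-congˡ (∑-* a xs f)) (≈-sym (distribˡ a (f x) (∑ xs f)))

  ∑-swap : ∀ {a b} {A : Set a} {B : Set b} (xs : List A) (ys : List B) (f : A → B → Carrier) →
    ∑ xs (λ x → ∑ ys (f x)) ≈ ∑ ys (λ y → ∑ xs (λ x → f x y))
  ∑-swap []       ys f = ≈-sym (∑-zero (All.universal (λ _ → ≈-refl) ys))
  ∑-swap (x ∷ xs) ys f = ≈-trans (+-congˡ (∑-swap xs ys f)) (≈-sym (∑-+ ys (f x) _))

  module _ {a ℓ} (S : Setoid a ℓ) where

    private
      module S = Setoid S

    -- A list without repetitions meets the class of `x` only once. The setoid is kept general
    -- because monomials are compared by `_≈ᵍ_` and orbit representatives by `_≅_`.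
    ∑-single : ∀ {ds x v} {f : S.Carrier → Carrier} → UniqueSetoid.Unique S ds → SetoidMembership._∈_ S x ds →
      (∀ {d} → x S.≈ d → f d ≈ v) → (∀ {d} → ¬ x S.≈ d → f d ≈ 0#) → ∑ ds f ≈ v
    ∑-single (d≉ds ∷ _) (here x≈d) hit miss = ≈-trans
      (+-cong (hit x≈d) (∑-zero (All.map (λ d≉y → miss λ x≈y → d≉y (S.trans (S.sym x≈d) x≈y)) d≉ds)))
      (+ᴷ-identityʳ _)
    ∑-single (d≉ds ∷ unique) (there x∈ds) hit miss = ≈-trans
      (+-cong (miss λ x≈d → Allₚ.All¬⇒¬Any d≉ds (Any.map (S.trans (S.sym x≈d)) x∈ds)) (∑-single unique x∈ds hit miss))
      (+ᴷ-identityˡ _)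

  -- Iverson brackets and linear functionals

  [_] : ∀ {p} {P : Set p} → Dec P → Carrier
  [ P? ] = if does P? then 1# else 0#

  []-true : ∀ {p} {P : Set p} (P? : Dec P) → P → [ P? ] ≈ 1#
  []-true P? p = ≈-reflexive (cong (if_then 1# else 0#) (dec-true P? p))

  []-false : ∀ {p} {P : Set p} (P? : Dec P) → ¬ P → [ P? ] ≈ 0#
  []-false P? ¬p = ≈-reflexive (cong (if_then 1# else 0#) (dec-false P? ¬p))

  []-cong : ∀ {p q} {P : Set p} {Q : Set q} (P? : Dec P) (Q? : Dec Q) → (P → Q) → (Q → P) → [ P? ] ≈ [ Q? ]
  []-cong P? Q? to from = ≈-reflexive (cong (if_then 1# else 0#) (does-⇔ (mk⇔ to from) P? Q?))

  if-[] : ∀ {p} {P : Set p} (P? : Dec P) a → (if does P? then a else 0#) ≈ a *ᴷ [ P? ]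
  if-[] P? a with does P?
  ... | true  = ≈-sym (*-identityʳ a)
  ... | false = ≈-sym (zeroʳ a)

  -- The value at p of the linear functional sending each monomial xᵍ to φ g; coefficients are the
  -- functionals δ h, and polynomial identities are checked on all functionals at once.
  ⟨_,_⟩ : Poly → (Multigraph n → Carrier) → Carrier
  ⟨ p , φ ⟩ = ∑ p λ t → proj₁ t *ᴷ φ (proj₂ t)

  δ : Multigraph n → Multigraph n → Carrier
  δ h g = [ g ≟ᵍ h ]

  coeff-δ : ∀ p h → coeff p h ≈ ⟨ p , δ h ⟩
  coeff-δ []            h = ≈-refl
  coeff-δ ((a , g) ∷ p) h = +-cong (if-[] (g ≟ᵍ h) a) (coeff-δ p h)

  -- A monomial determines its exponent only up to `_≈ᵍ_`, so only these `φ` give functionals that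
  -- respect `_≈ₚ_`.
  Extensional : (Multigraph n → Carrier) → Set ℓ₁
  Extensional φ = ∀ g h → g ≈ᵍ h → φ g ≈ φ h

  δ-extensional : ∀ h → Extensional (δ h)
  δ-extensional h g k g≈k = []-cong (g ≟ᵍ h) (k ≟ᵍ h)
    (λ g≈h i j → trans (sym (g≈k i j)) (g≈h i j)) (λ k≈h i j → trans (g≈k i j) (k≈h i j))

  private
    ≈ᵍ-setoid : Setoid 0ℓ 0ℓ
    ≈ᵍ-setoid = DecSetoid.setoid (≈ᵍ-decSetoid {n})
    open SetoidMembership ≈ᵍ-setoid using () renaming (_∈_ to _∈ᵍ_)

  -- Grouping the formal terms of `p` by exponent: each term contributes to exactly one entry of
  -- `D`.
  collect : ∀ {D} → UniqueSetoid.Unique ≈ᵍ-setoid D → ∀ {φ} → Extensional φ →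
    ∀ p → All (λ t → proj₂ t ∈ᵍ D) p → ⟨ p , φ ⟩ ≈ ∑ D (λ d → coeff p d *ᴷ φ d)
  collect {D} unique {φ} φ-ext [] _ = ≈-sym (∑-zero (All.universal (λ d → zeroˡ (φ d)) D))
  collect {D} unique {φ} φ-ext ((a , g) ∷ p) (g∈D ∷ p⊆D) = begin
    a *ᴷ φ g +ᴷ ⟨ p , φ ⟩
      ≈⟨ +-cong (≈-sym (∑-single ≈ᵍ-setoid {x = g} unique g∈D hit miss)) (collect unique φ-ext p p⊆D) ⟩
    ∑ D (λ d → (if does (g ≟ᵍ d) then a else 0#) *ᴷ φ d) +ᴷ ∑ D (λ d → coeff p d *ᴷ φ d)
      ≈⟨ ∑-+ D _ _ ⟨
    ∑ D (λ d → (if does (g ≟ᵍ d) then a else 0#) *ᴷ φ d +ᴷ coeff p d *ᴷ φ d)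
      ≈⟨ ∑-cong D (λ d → distribʳ (φ d) _ (coeff p d)) ⟨
    ∑ D (λ d → coeff ((a , g) ∷ p) d *ᴷ φ d) ∎
    where
    open SetoidReasoning K-setoid
    hit : ∀ {d} → g ≈ᵍ d → (if does (g ≟ᵍ d) then a else 0#) *ᴷ φ d ≈ a *ᴷ φ g
    hit {d} g≈d = *-cong (≈-reflexive (cong (if_then a else 0#) (dec-true (g ≟ᵍ d) g≈d)))
      (φ-ext d g λ i j → sym (g≈d i j))
    miss : ∀ {d} → ¬ g ≈ᵍ d → (if does (g ≟ᵍ d) then a else 0#) *ᴷ φ d ≈ 0#
    miss {d} g≉d = ≈-trans
      (*-congʳ (≈-reflexive (cong (if_then a else 0#) (dec-false (g ≟ᵍ d) g≉d)))) (zeroˡ (φ d))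

  module _ (p q : Poly) where

    -- Collected over one list that contains the exponents of both polynomials, the two values
    -- become sums that depend on the coefficients only.
    ≈ₚ-elim : p ≈ₚ q → ∀ {φ} → Extensional φ → ⟨ p , φ ⟩ ≈ ⟨ q , φ ⟩
    ≈ₚ-elim p≈q {φ} φ-ext = begin
      ⟨ p , φ ⟩                       ≈⟨ collect unique φ-ext p (All.tabulate λ t∈ → listed (Anyₚ.++⁺ˡ {ys = q} t∈)) ⟩
      ∑ D (λ d → coeff p d *ᴷ φ d)    ≈⟨ ∑-cong D (λ d → *-congʳ (p≈q d)) ⟩
      ∑ D (λ d → coeff q d *ᴷ φ d)    ≈⟨ collect unique φ-ext q (All.tabulate λ t∈ → listed (Anyₚ.++⁺ʳ p t∈)) ⟨
      ⟨ q , φ ⟩                       ∎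
      where
      open SetoidReasoning K-setoid
      D : List (Multigraph n)
      D = deduplicate _≟ᵍ_ (map proj₂ (p ++ q))
      unique : UniqueSetoid.Unique ≈ᵍ-setoid D
      unique = deduplicate-! (≈ᵍ-decSetoid {n}) (map proj₂ (p ++ q))
      listed : ∀ {t} → t ∈ p ++ q → proj₂ t ∈ᵍ D
      listed {t} t∈ = ∈-deduplicate⁺ ≈ᵍ-setoid _≟ᵍ_
        (λ z≈y x≈y i j → trans (x≈y i j) (sym (z≈y i j))) {z = proj₂ t}
        (Any.map (λ { refl i j → refl }) (∈-map⁺ proj₂ t∈))

    ≈ₚ-intro : (∀ {φ} → Extensional φ → ⟨ p , φ ⟩ ≈ ⟨ q , φ ⟩) → p ≈ₚ q
    ≈ₚ-intro eq h = ≈-trans (coeff-δ p h) (≈-trans (eq (δ-extensional h)) (≈-sym (coeff-δ q h)))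

  ⟨⟩-cong : ∀ p {φ ψ} → (∀ g → φ g ≈ ψ g) → ⟨ p , φ ⟩ ≈ ⟨ p , ψ ⟩
  ⟨⟩-cong p eq = ∑-cong p λ t → *-congˡ (eq (proj₂ t))

  ⟨⟩-+ₚ : ∀ p q φ → ⟨ p +ₚ q , φ ⟩ ≈ ⟨ p , φ ⟩ +ᴷ ⟨ q , φ ⟩
  ⟨⟩-+ₚ p q φ = ∑-++ p q _

  ⟨⟩-·ₚ : ∀ a p φ → ⟨ a ·ₚ p , φ ⟩ ≈ a *ᴷ ⟨ p , φ ⟩
  ⟨⟩-·ₚ a []            φ = ≈-sym (zeroʳ a)
  ⟨⟩-·ₚ a ((b , g) ∷ p) φ = ≈-trans (+-cong (*ᴷ-assoc a b (φ g)) (⟨⟩-·ₚ a p φ)) (≈-sym (distribˡ a _ _))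

  ⟨⟩-act : ∀ σ p φ → ⟨ act σ p , φ ⟩ ≈ ⟨ p , (λ g → φ (σ • g)) ⟩
  ⟨⟩-act σ []            φ = ≈-refl
  ⟨⟩-act σ ((a , g) ∷ p) φ = +-congˡ (⟨⟩-act σ p φ)

  -- Multiplication becomes iterated evaluation, so the laws of `_*ₚ_` reduce to the laws of `_+ᵍ_`
  -- under `φ` and, for commutativity, to exchanging two sums.
  ⟨⟩-*ₚ : ∀ p q φ → ⟨ p *ₚ q , φ ⟩ ≈ ⟨ p , (λ f → ⟨ q , (λ g → φ (f +ᵍ g)) ⟩) ⟩
  ⟨⟩-*ₚ []            q φ = ≈-refl
  ⟨⟩-*ₚ ((a , f) ∷ p) q φ = ≈-trans (∑-++ (map _ q) (p *ₚ q) _) (+-cong (row q) (⟨⟩-*ₚ p q φ))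
    where
    row : ∀ q → ⟨ map (λ { (b , g) → (a *ᴷ b , f +ᵍ g) }) q , φ ⟩ ≈ a *ᴷ ⟨ q , (λ g → φ (f +ᵍ g)) ⟩
    row []            = ≈-sym (zeroʳ a)
    row ((b , g) ∷ q) = ≈-trans (+-cong (*ᴷ-assoc a b _) (row q)) (≈-sym (distribˡ a _ _))

  ⟨⟩-swap : ∀ p q (ψ : Multigraph n → Multigraph n → Carrier) →
    ⟨ p , (λ f → ⟨ q , ψ f ⟩) ⟩ ≈ ⟨ q , (λ g → ⟨ p , (λ f → ψ f g) ⟩) ⟩
  ⟨⟩-swap p q ψ = begin
    ∑ p (λ s → proj₁ s *ᴷ ∑ q (λ t → proj₁ t *ᴷ ψ (proj₂ s) (proj₂ t)))
      ≈⟨ ∑-cong p (λ s → ∑-* (proj₁ s) q _) ⟨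
    ∑ p (λ s → ∑ q (λ t → proj₁ s *ᴷ (proj₁ t *ᴷ ψ (proj₂ s) (proj₂ t))))
      ≈⟨ ∑-swap p q _ ⟩
    ∑ q (λ t → ∑ p (λ s → proj₁ s *ᴷ (proj₁ t *ᴷ ψ (proj₂ s) (proj₂ t))))
      ≈⟨ ∑-cong q (λ t → ≈-trans (∑-cong p (λ s → x∙yz≈y∙xz (proj₁ s) (proj₁ t) _)) (∑-* (proj₁ t) p _)) ⟩
    ∑ q (λ t → proj₁ t *ᴷ ∑ p (λ s → proj₁ s *ᴷ ψ (proj₂ s) (proj₂ t))) ∎
    where open SetoidReasoning K-setoid

  coeff-+ₚ : ∀ p q h → coeff (p +ₚ q) h ≈ coeff p h +ᴷ coeff q h
  coeff-+ₚ p q h = ≈-trans (coeff-δ (p +ₚ q) h) (≈-trans (⟨⟩-+ₚ p q (δ h))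
    (≈-sym (+-cong (coeff-δ p h) (coeff-δ q h))))

  coeff-·ₚ : ∀ a p h → coeff (a ·ₚ p) h ≈ a *ᴷ coeff p h
  coeff-·ₚ a p h = ≈-trans (coeff-δ (a ·ₚ p) h) (≈-trans (⟨⟩-·ₚ a p (δ h)) (≈-sym (*-congˡ (coeff-δ p h))))

  coeff-extensional : ∀ p g h → g ≈ᵍ h → coeff p g ≈ coeff p h
  coeff-extensional p g h g≈h = ≈-trans (coeff-δ p g) (≈-trans
    (⟨⟩-cong p λ f → []-cong (f ≟ᵍ g) (f ≟ᵍ h)
      (λ f≈g i j → trans (f≈g i j) (g≈h i j)) (λ f≈h i j → trans (f≈h i j) (sym (g≈h i j))))
    (≈-sym (coeff-δ p h)))

  private
    shift-extensional : ∀ {φ} → Extensional φ → ∀ f → Extensional (λ g → φ (f +ᵍ g))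
    shift-extensional φ-ext f g h g≈h = φ-ext _ _ λ i j → cong (mult f i j +_) (g≈h i j)

    ⟨⟩-shift-extensional : ∀ q {φ} → Extensional φ → Extensional (λ f → ⟨ q , (λ g → φ (f +ᵍ g)) ⟩)
    ⟨⟩-shift-extensional q φ-ext f g f≈g = ⟨⟩-cong q λ h → φ-ext _ _ λ i j → cong (_+ mult h i j) (f≈g i j)

  *ₚ-cong : ∀ {p p′ q q′} → p ≈ₚ p′ → q ≈ₚ q′ → p *ₚ q ≈ₚ p′ *ₚ q′
  *ₚ-cong {p} {p′} {q} {q′} p≈p′ q≈q′ = ≈ₚ-intro (p *ₚ q) (p′ *ₚ q′) λ {φ} φ-ext → begin
    ⟨ p *ₚ q , φ ⟩                                     ≈⟨ ⟨⟩-*ₚ p q φ ⟩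
    ⟨ p , (λ f → ⟨ q , (λ g → φ (f +ᵍ g)) ⟩) ⟩         ≈⟨ ≈ₚ-elim p p′ p≈p′ (⟨⟩-shift-extensional q φ-ext) ⟩
    ⟨ p′ , (λ f → ⟨ q , (λ g → φ (f +ᵍ g)) ⟩) ⟩        ≈⟨ ⟨⟩-cong p′ (λ f → ≈ₚ-elim q q′ q≈q′ (shift-extensional φ-ext f)) ⟩
    ⟨ p′ , (λ f → ⟨ q′ , (λ g → φ (f +ᵍ g)) ⟩) ⟩       ≈⟨ ⟨⟩-*ₚ p′ q′ φ ⟨
    ⟨ p′ *ₚ q′ , φ ⟩                                   ∎
    where open SetoidReasoning K-setoid

  *ₚ-comm : ∀ p q → p *ₚ q ≈ₚ q *ₚ p
  *ₚ-comm p q = ≈ₚ-intro (p *ₚ q) (q *ₚ p) λ {φ} φ-ext → begin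
    ⟨ p *ₚ q , φ ⟩                                     ≈⟨ ⟨⟩-*ₚ p q φ ⟩
    ⟨ p , (λ f → ⟨ q , (λ g → φ (f +ᵍ g)) ⟩) ⟩         ≈⟨ ⟨⟩-swap p q _ ⟩
    ⟨ q , (λ g → ⟨ p , (λ f → φ (f +ᵍ g)) ⟩) ⟩         ≈⟨ ⟨⟩-cong q (λ g → ⟨⟩-cong p λ f →
                                                            φ-ext _ _ λ i j → +-comm (mult f i j) (mult g i j)) ⟩
    ⟨ q , (λ g → ⟨ p , (λ f → φ (g +ᵍ f)) ⟩) ⟩         ≈⟨ ⟨⟩-*ₚ q p φ ⟨
    ⟨ q *ₚ p , φ ⟩                                     ∎
    where open SetoidReasoning K-setoid

  *ₚ-assoc : ∀ p q r → (p *ₚ q) *ₚ r ≈ₚ p *ₚ (q *ₚ r)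
  *ₚ-assoc p q r = ≈ₚ-intro ((p *ₚ q) *ₚ r) (p *ₚ (q *ₚ r)) λ {φ} φ-ext → begin
    ⟨ (p *ₚ q) *ₚ r , φ ⟩
      ≈⟨ ⟨⟩-*ₚ (p *ₚ q) r φ ⟩
    ⟨ p *ₚ q , (λ f → ⟨ r , (λ h → φ (f +ᵍ h)) ⟩) ⟩
      ≈⟨ ⟨⟩-*ₚ p q _ ⟩
    ⟨ p , (λ f → ⟨ q , (λ g → ⟨ r , (λ h → φ (f +ᵍ g +ᵍ h)) ⟩) ⟩) ⟩
      ≈⟨ ⟨⟩-cong p (λ f → ⟨⟩-cong q λ g → ⟨⟩-cong r λ h → φ-ext _ _ λ i j →
           +-assoc (mult f i j) (mult g i j) (mult h i j)) ⟩
    ⟨ p , (λ f → ⟨ q , (λ g → ⟨ r , (λ h → φ (f +ᵍ (g +ᵍ h))) ⟩) ⟩) ⟩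
      ≈⟨ ⟨⟩-cong p (λ f → ⟨⟩-*ₚ q r _) ⟨
    ⟨ p , (λ f → ⟨ q *ₚ r , (λ g → φ (f +ᵍ g)) ⟩) ⟩
      ≈⟨ ⟨⟩-*ₚ p (q *ₚ r) φ ⟨
    ⟨ p *ₚ (q *ₚ r) , φ ⟩ ∎
    where open SetoidReasoning K-setoid

  *ₚ-identityˡ : ∀ p → 1ₚ *ₚ p ≈ₚ p
  *ₚ-identityˡ p = ≈ₚ-intro (1ₚ *ₚ p) p λ {φ} φ-ext → begin
    ⟨ 1ₚ *ₚ p , φ ⟩                                    ≈⟨ ⟨⟩-*ₚ 1ₚ p φ ⟩
    1# *ᴷ ⟨ p , (λ g → φ (∅ᵍ +ᵍ g)) ⟩ +ᴷ 0#            ≈⟨ +ᴷ-identityʳ _ ⟩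
    1# *ᴷ ⟨ p , (λ g → φ (∅ᵍ +ᵍ g)) ⟩                  ≈⟨ *-identityˡ _ ⟩
    ⟨ p , (λ g → φ (∅ᵍ +ᵍ g)) ⟩                        ≈⟨ ⟨⟩-cong p (λ g → φ-ext _ g λ i j → refl) ⟩
    ⟨ p , φ ⟩                                          ∎
    where open SetoidReasoning K-setoid

  *ₚ-commutativeMonoid : CommutativeMonoid c ℓ₁
  *ₚ-commutativeMonoid = record
    { Carrier = Poly
    ; _≈_ = _≈ₚ_
    ; _∙_ = _*ₚ_
    ; ε = 1ₚ
    ; isCommutativeMonoid = isCommutativeMonoidˡ record
      { isSemigroup = record
        { isMagma = record
          { isEquivalence = record
            { refl = λ g → ≈-refl
            ; sym = λ p≈q g → ≈-sym (p≈q g)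
            ; trans = λ p≈q q≈r g → ≈-trans (p≈q g) (q≈r g)
            }
          ; ∙-cong = λ {p} {p′} {q} {q′} → *ₚ-cong {p} {p′} {q} {q′}
          }
        ; assoc = *ₚ-assoc
        }
      ; identityˡ = *ₚ-identityˡ
      ; comm = *ₚ-comm
      }
    }

-- Orbit sums

module InvariantBasis {c ℓ₁ ℓ₂} (K : HeytingField c ℓ₁ ℓ₂) (n : ℕ) where

  open InvariantRing K n
  open PolynomialAlgebra K n
  open Mult (CommutativeRing.semiring K-ring) using () renaming (_×_ to _·_)
  open HeytingCommutativeRingProperties (HeytingField.heytingCommutativeRing K) using (x-0≈x)
  open RingProperties (CommutativeRing.ring K-ring) using (-0#≈0#; -1*x≈-x)

  -- Invariance read off from the coefficients.
  ClassFunction : Poly → Set ℓ₁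
  ClassFunction p = ∀ {g h} → g ≅ h → coeff p g ≈ coeff p h

  coeff-act : ∀ σ p h → coeff (act σ p) (σ • h) ≈ coeff p h
  coeff-act σ p h = begin
    coeff (act σ p) (σ • h)               ≈⟨ coeff-δ (act σ p) (σ • h) ⟩
    ⟨ act σ p , δ (σ • h) ⟩               ≈⟨ ⟨⟩-act σ p (δ (σ • h)) ⟩
    ⟨ p , (λ g → δ (σ • h) (σ • g)) ⟩     ≈⟨ ⟨⟩-cong p (λ g → []-cong (σ • g ≟ᵍ σ • h) (g ≟ᵍ h) (cancel g)
                                               (λ g≈h i j → g≈h (σ ⟨$⟩ˡ i) (σ ⟨$⟩ˡ j))) ⟩
    ⟨ p , δ h ⟩                           ≈⟨ coeff-δ p h ⟨
    coeff p h                             ∎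
    where
    open SetoidReasoning K-setoid
    cancel : ∀ g → σ • g ≈ᵍ σ • h → g ≈ᵍ h
    cancel g eq i j = trans (sym (•-≈-elim g (σ • h) σ eq i j))
      (•-≈-elim h (σ • h) σ (λ i j → refl) i j)

  invariant⇒classFunction : ∀ p → Invariant p → ClassFunction p
  invariant⇒classFunction p inv {g} {h} (iso σ eq) = ≈-trans (≈-sym (coeff-act σ p g))
    (≈-trans (inv σ (σ • g)) (coeff-extensional p (σ • g) h eq))

  classFunction⇒invariant : ∀ p → ClassFunction p → Invariant p
  classFunction⇒invariant p class σ h = ≈-trans
    (coeff-extensional (act σ p) h (σ • (flip σ • h)) (λ i j → sym (cong₂ (mult h) (inverseʳ σ) (inverseʳ σ))))
    (≈-trans (coeff-act σ p (flip σ • h)) (≈-sym (class (•-≅ (flip σ) h))))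

  invariant-resp : ∀ p q → p ≈ₚ q → Invariant p → Invariant q
  invariant-resp p q p≈q inv = classFunction⇒invariant q λ {g} {h} g≅h →
    ≈-trans (≈-sym (p≈q g)) (≈-trans (invariant⇒classFunction p inv g≅h) (p≈q h))

  invariant-+ₚ : ∀ p q → Invariant p → Invariant q → Invariant (p +ₚ q)
  invariant-+ₚ p q ip iq = classFunction⇒invariant (p +ₚ q) λ {g} {h} g≅h →
    ≈-trans (coeff-+ₚ p q g) (≈-trans
      (+-cong (invariant⇒classFunction p ip g≅h) (invariant⇒classFunction q iq g≅h))
      (≈-sym (coeff-+ₚ p q h)))

  invariant-·ₚ : ∀ a p → Invariant p → Invariant (a ·ₚ p)
  invariant-·ₚ a p ip = classFunction⇒invariant (a ·ₚ p) λ {g} {h} g≅h →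
    ≈-trans (coeff-·ₚ a p g) (≈-trans (*-congˡ (invariant⇒classFunction p ip g≅h)) (≈-sym (coeff-·ₚ a p h)))

  invariant-const : ∀ a → Invariant (const a)
  invariant-const a σ g = ≈-refl

  invariant-*ₚ : ∀ p q → Invariant p → Invariant q → Invariant (p *ₚ q)
  invariant-*ₚ p q ip iq σ h = ≈-trans (act-*ₚ h)
    (*ₚ-cong {act σ p} {p} {act σ q} {q} (ip σ) (iq σ) h)
    where
    act-*ₚ : act σ (p *ₚ q) ≈ₚ act σ p *ₚ act σ q
    act-*ₚ = ≈ₚ-intro (act σ (p *ₚ q)) (act σ p *ₚ act σ q) λ {φ} φ-ext → begin
      ⟨ act σ (p *ₚ q) , φ ⟩                                        ≈⟨ ⟨⟩-act σ (p *ₚ q) φ ⟩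
      ⟨ p *ₚ q , (λ g → φ (σ • g)) ⟩                                ≈⟨ ⟨⟩-*ₚ p q _ ⟩
      ⟨ p , (λ f → ⟨ q , (λ g → φ (σ • (f +ᵍ g))) ⟩) ⟩              ≈⟨ ⟨⟩-cong p (λ f → ⟨⟩-cong q λ g → φ-ext _ _ λ i j → refl) ⟩
      ⟨ p , (λ f → ⟨ q , (λ g → φ (σ • f +ᵍ σ • g)) ⟩) ⟩            ≈⟨ ⟨⟩-cong p (λ f → ⟨⟩-act σ q (λ g → φ (σ • f +ᵍ g))) ⟨
      ⟨ p , (λ f → ⟨ act σ q , (λ g → φ (σ • f +ᵍ g)) ⟩) ⟩          ≈⟨ ⟨⟩-act σ p _ ⟨
      ⟨ act σ p , (λ f → ⟨ act σ q , (λ g → φ (f +ᵍ g)) ⟩) ⟩        ≈⟨ ⟨⟩-*ₚ (act σ p) (act σ q) φ ⟨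
      ⟨ act σ p *ₚ act σ q , φ ⟩                                    ∎
      where open SetoidReasoning K-setoid

  -- Each member of the orbit is listed once, so the coefficient is 1 on the whole class and not the
  -- order of a stabiliser.
  coeff-𝓞 : ∀ g h → coeff (𝓞 g) h ≈ [ g ≅? h ]
  coeff-𝓞 g h = ≈-trans (unfold (orbit g)) (count (g ≅? h))
    where
    unfold : ∀ D → coeff (map (1# ,_) D) h ≈ ∑ D λ d → [ d ≟ᵍ h ]
    unfold []      = ≈-refl
    unfold (d ∷ D) = +-congˡ (unfold D)
    count : (dec : Dec (g ≅ h)) → ∑ (orbit g) (λ d → [ d ≟ᵍ h ]) ≈ [ dec ]
    count (yes g≅h) = ∑-single (DecSetoid.setoid (≈ᵍ-decSetoid {n})) {x = h} (orbit-unique g) (∈-orbit⁺ g g≅h)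
      (λ {d} h≈d → []-true (d ≟ᵍ h) λ i j → sym (h≈d i j))
      (λ {d} h≉d → []-false (d ≟ᵍ h) λ d≈h → h≉d λ i j → sym (d≈h i j))
    count (no g≇h) = ∑-zero (All.map
      (λ {d} g≅d → []-false (d ≟ᵍ h) λ d≈h → g≇h (≅-trans g≅d (≈ᵍ⇒≅ d≈h))) (∈-orbit⁻ g))

  classFunction-𝓞 : ∀ g → ClassFunction (𝓞 g)
  classFunction-𝓞 g {h} {k} h≅k = ≈-trans (coeff-𝓞 g h) (≈-trans
    ([]-cong (g ≅? h) (g ≅? k) (λ g≅h → ≅-trans g≅h h≅k) (λ g≅k → ≅-trans g≅k (≅-sym h≅k)))
    (≈-sym (coeff-𝓞 g k)))

  invariant-𝓞 : ∀ g → Invariant (𝓞 g)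
  invariant-𝓞 g = classFunction⇒invariant (𝓞 g) (classFunction-𝓞 g)

  𝓞-cong : ∀ {g h} → g ≅ h → 𝓞 g ≈ₚ 𝓞 h
  𝓞-cong {g} {h} g≅h k = ≈-trans (coeff-𝓞 g k) (≈-trans
    ([]-cong (g ≅? k) (h ≅? k) (≅-trans (≅-sym g≅h)) (≅-trans g≅h))
    (≈-sym (coeff-𝓞 h k)))

  -- Syntactic occurrence in the list of terms. It is decidable, and its failure forces the
  -- coefficient to vanish, which suffices for all case distinctions.
  HasTerm : Poly → Multigraph n → Set c
  HasTerm p h = Any.Any (λ t → proj₂ t ≈ᵍ h) p

  hasTerm? : ∀ p h → Dec (HasTerm p h)
  hasTerm? p h = Any.any? (λ t → proj₂ t ≟ᵍ h) p

  coeff-noTerm : ∀ p h → ¬ HasTerm p h → coeff p h ≈ 0#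
  coeff-noTerm p h ¬term = ≈-trans (coeff-δ p h) (∑-zero (All.map
    (λ {t} t≉h → ≈-trans (*-congˡ ([]-false (proj₂ t ≟ᵍ h) t≉h)) (zeroʳ (proj₁ t))) (Allₚ.¬Any⇒All¬ p ¬term)))

  orbitExpansion : Poly → Poly
  orbitExpansion p = concatMap (λ g → coeff p g ·ₚ 𝓞 g) (deduplicate _≅?_ (map proj₂ p))

  -- `D` holds one representative of each isomorphism class met by the terms of `p`. At `h` only the
  -- representative of its class contributes, with the coefficient that `p` has on the whole class;
  -- if the class is not met, both sides vanish.
  invariant≈orbitExpansion : ∀ p → Invariant p → p ≈ₚ orbitExpansion p
  invariant≈orbitExpansion p inv h = ≈-sym (≈-trans (coeff-concatMap D) (≈-trans
    (∑-cong D λ d → ≈-trans (coeff-·ₚ (coeff p d) (𝓞 d) h) (*-congˡ (coeff-𝓞 d h)))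
    (evaluate (Any.any? (h ≅?_) D))))
    where
    ≅-setoid : Setoid 0ℓ 0ℓ
    ≅-setoid = DecSetoid.setoid (≅-decSetoid {n})
    D : List (Multigraph n)
    D = deduplicate _≅?_ (map proj₂ p)
    coeff-concatMap : ∀ ds → coeff (concatMap (λ g → coeff p g ·ₚ 𝓞 g) ds) h ≈ ∑ ds (λ d → coeff (coeff p d ·ₚ 𝓞 d) h)
    coeff-concatMap []       = ≈-refl
    coeff-concatMap (d ∷ ds) = ≈-trans (coeff-+ₚ (coeff p d ·ₚ 𝓞 d) _ h) (+-congˡ (coeff-concatMap ds))
    term⇒listed : HasTerm p h → Any.Any (h ≅_) D
    term⇒listed term = ∈-deduplicate⁺ ≅-setoid _≅?_ (λ z≅y x≅y → ≅-trans x≅y (≅-sym z≅y))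
      (Anyₚ.map⁺ (Any.map (λ t≈h → ≅-sym (≈ᵍ⇒≅ t≈h)) term))
    evaluate : Dec (Any.Any (h ≅_) D) → ∑ D (λ d → coeff p d *ᴷ [ d ≅? h ]) ≈ coeff p h
    evaluate (yes listed) = ∑-single ≅-setoid {x = h} (deduplicate-! ≅-decSetoid (map proj₂ p)) listed
      (λ {d} h≅d → ≈-trans (*-congˡ ([]-true (d ≅? h) (≅-sym h≅d)))
        (≈-trans (*-identityʳ _) (invariant⇒classFunction p inv (≅-sym h≅d))))
      (λ {d} h≇d → ≈-trans (*-congˡ ([]-false (d ≅? h) (h≇d ∘ ≅-sym))) (zeroʳ _))
    evaluate (no ¬listed) = ≈-trans
      (∑-zero (All.map (λ {d} h≇d → ≈-trans (*-congˡ ([]-false (d ≅? h) (h≇d ∘ ≅-sym))) (zeroʳ _))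
        (Allₚ.¬Any⇒All¬ D ¬listed)))
      (≈-sym (coeff-noTerm p h (¬listed ∘ term⇒listed)))

  -- Common frame for the span of the products and the subalgebra generated by the quasi-connected
  -- orbit sums.
  record IsSubspace {ℓ} (V : Pred Poly ℓ) : Set (c ⊔ ℓ₁ ⊔ ℓ) where
    field
      V-resp  : ∀ p q → p ≈ₚ q → V p → V q
      V-0     : V 0ₚ
      V-+     : ∀ p q → V p → V q → V (p +ₚ q)
      V-·     : ∀ a p → V p → V (a ·ₚ p)

  module _ {ℓ} {V : Pred Poly ℓ} (subspace : IsSubspace V) where

    open IsSubspace subspace

    -- The disjunction in the hypothesis replaces a test of whether the coefficient is zero: each
    -- orbit of the expansion is either known to drop out or known to lie in `V`.
    invariant∈subspace : ∀ p → Invariant p → (∀ h → coeff p h ≈ 0# ⊎ V (𝓞 h)) → V p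
    invariant∈subspace p inv orbits = V-resp (orbitExpansion p) p (λ h → ≈-sym (invariant≈orbitExpansion p inv h))
      (expansion∈ (deduplicate _≅?_ (map proj₂ p)))
      where
      expansion∈ : ∀ ds → V (concatMap (λ g → coeff p g ·ₚ 𝓞 g) ds)
      expansion∈ []       = V-0
      expansion∈ (d ∷ ds) = V-+ (coeff p d ·ₚ 𝓞 d) _ (case orbits d of λ where
        (inj₁ c≈0) → V-resp 0ₚ (coeff p d ·ₚ 𝓞 d)
          (λ h → ≈-sym (≈-trans (coeff-·ₚ (coeff p d) (𝓞 d) h) (≈-trans (*-congʳ c≈0) (zeroˡ _)))) V-0
        (inj₂ v)    → V-· (coeff p d) (𝓞 d) v) (expansion∈ ds)

  -- Products of orbit sums

  Unitary : Poly → Set (c ⊔ ℓ₁)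
  Unitary p = All (λ t → proj₁ t ≈ 1#) p

  coeff-unitary : ∀ p → Unitary p → ∀ h → ∃[ m ] coeff p h ≈ m · 1#
  coeff-unitary []            _          h = 0 , ≈-refl
  coeff-unitary ((a , g) ∷ p) (a≈1 ∷ up) h with does (g ≟ᵍ h) | coeff-unitary p up h
  ... | true  | m , eq = suc m , +-cong a≈1 eq
  ... | false | m , eq = m , ≈-trans (+ᴷ-identityˡ _) eq

  -- The coefficient counts the listed terms equal to `h`, and at least one is present.
  coeff-term : ∀ p → Unitary p → ∀ h → HasTerm p h → ∃[ m ] coeff p h ≈ suc m · 1#
  coeff-term ((a , g) ∷ p) (a≈1 ∷ up) h (here g≈h) =
    let m , eq = coeff-unitary p up h in
    m , +-cong (≈-trans (≈-reflexive (cong (if_then a else 0#) (dec-true (g ≟ᵍ h) g≈h))) a≈1) eq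
  coeff-term ((a , g) ∷ p) (a≈1 ∷ up) h (there term) with does (g ≟ᵍ h) | coeff-term p up h term
  ... | true  | m , eq = suc m , +-cong a≈1 eq
  ... | false | m , eq = m , ≈-trans (+ᴷ-identityˡ _) eq

  unitary-*ₚ : ∀ p q → Unitary p → Unitary q → Unitary (p *ₚ q)
  unitary-*ₚ p q up uq = Allₚ.cartesianProductWith⁺ (≡-setoid _) (≡-setoid _) _ p q λ x∈ y∈ →
    ≈-trans (*-cong (All.lookup up x∈) (All.lookup uq y∈)) (*-identityˡ 1#)

  hasTerm-*ₚ⁺ : ∀ p q f g → HasTerm p f → HasTerm q g → HasTerm (p *ₚ q) (f +ᵍ g)
  hasTerm-*ₚ⁺ p q f g = Anyₚ.cartesianProductWith⁺ _ λ s≈f t≈g i j → cong₂ _+_ (s≈f i j) (t≈g i j)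

  hasTerm-*ₚ⁻ : ∀ p q h → HasTerm (p *ₚ q) h → ∃₂ λ f g → HasTerm p f × HasTerm q g × f +ᵍ g ≈ᵍ h
  hasTerm-*ₚ⁻ p q h term with find term
  ... | t , t∈ , t≈h with ∈-cartesianProductWith⁻ _ p q t∈
  ...   | (a , f) , (b , g) , s∈ , u∈ , refl = f , g , lose s∈ (λ i j → refl) , lose u∈ (λ i j → refl) , t≈h

  product𝓞 : List (Multigraph n) → Poly
  product𝓞 cs = productₚ (map 𝓞 cs)

  unitary-product𝓞 : ∀ cs → Unitary (product𝓞 cs)
  unitary-product𝓞 []       = ≈-refl ∷ []
  unitary-product𝓞 (g ∷ cs) = unitary-*ₚ (𝓞 g) (product𝓞 cs)
    (Allₚ.map⁺ (All.universal (λ _ → ≈-refl) (orbit g))) (unitary-product𝓞 cs)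

  invariant-product𝓞 : ∀ cs → Invariant (product𝓞 cs)
  invariant-product𝓞 []       = invariant-const 1#
  invariant-product𝓞 (g ∷ cs) = invariant-*ₚ (𝓞 g) (product𝓞 cs) (invariant-𝓞 g) (invariant-product𝓞 cs)

  hasTerm-product𝓞⁺ : ∀ {cs hs} → Pointwise _≅_ cs hs → HasTerm (product𝓞 cs) (⨁ hs)
  hasTerm-product𝓞⁺ [] = here λ i j → refl
  hasTerm-product𝓞⁺ {g ∷ cs} {h ∷ hs} (g≅h ∷ isos) = hasTerm-*ₚ⁺ (𝓞 g) (product𝓞 cs) h (⨁ hs)
    (Anyₚ.map⁺ (Any.map (λ h≈d i j → sym (h≈d i j)) (∈-orbit⁺ g g≅h))) (hasTerm-product𝓞⁺ isos)

  hasTerm-product𝓞⁻ : ∀ cs h → HasTerm (product𝓞 cs) h → ∃[ hs ] Pointwise _≅_ cs hs × ⨁ hs ≈ᵍ h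
  hasTerm-product𝓞⁻ [] h (here ∅≈h) = [] , [] , ∅≈h
  hasTerm-product𝓞⁻ (g ∷ cs) h term with hasTerm-*ₚ⁻ (𝓞 g) (product𝓞 cs) h term
  ... | f , k , f-term , k-term , f+k≈h with hasTerm-product𝓞⁻ cs k k-term
  ...   | hs , isos , ⨁≈k = f ∷ hs , g≅f ∷ isos , λ i j → trans (cong (mult f i j +_) (⨁≈k i j)) (f+k≈h i j)
    where
    g≅f : g ≅ f
    g≅f with find (Anyₚ.map⁻ f-term)
    ... | d , d∈ , d≈f = ≅-trans (All.lookup (∈-orbit⁻ g) d∈) (≈ᵍ⇒≅ d≈f)

  product𝓞-cong : ∀ {gs hs} → Pointwise _≅_ gs hs → product𝓞 gs ≈ₚ product𝓞 hs
  product𝓞-cong [] g = ≈-refl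
  product𝓞-cong {g ∷ gs} {h ∷ hs} (g≅h ∷ isos) =
    *ₚ-cong {𝓞 g} {𝓞 h} {product𝓞 gs} {product𝓞 hs} (𝓞-cong g≅h) (product𝓞-cong isos)

  𝓞-∅ : 𝓞 ∅ᵍ ≈ₚ 1ₚ
  𝓞-∅ h = ≈-trans (coeff-𝓞 ∅ᵍ h) (≈-trans
    ([]-cong (∅ᵍ ≅? h) (∅ᵍ ≟ᵍ h) (λ (iso σ eq) → eq) ≈ᵍ⇒≅) (≈-sym (+ᴷ-identityʳ _)))

  -- Relabelling `gs` by `σ` turns the isomorphism of sums into an equality and leaves the orbit
  -- sums unchanged. Uniqueness of components then applies with `𝓞` as the multiplicative function.
  product𝓞-unique : ∀ gs hs → All QuasiConnected gs → All QuasiConnected hs →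
    PairwiseDisjoint gs → PairwiseDisjoint hs → ⨁ gs ≅ ⨁ hs → product𝓞 gs ≈ₚ product𝓞 hs
  product𝓞-unique gs hs gqcs hqcs gdisjs hdisjs (iso σ eq) k = ≈-trans
    (product𝓞-cong (map-•-≅ σ gs) k)
    (∏-⨁-unique *ₚ-commutativeMonoid 𝓞 (λ g h g≈h → 𝓞-cong {g} {h} (≈ᵍ⇒≅ g≈h)) 𝓞-∅ (map (σ •_) gs) hs
      (quasiConnected-all-≅ (map-•-≅ σ gs) gqcs) hqcs (disjoint-• σ gs gdisjs) hdisjs
      (λ i j → trans (sym (⨁-• σ gs i j)) (eq i j)) k)

  term-edges : ∀ cs h → HasTerm (product𝓞 cs) h → edges h ≡ total (map edges cs)
  term-edges cs h term = let hs , isos , ⨁≈h = hasTerm-product𝓞⁻ cs h term in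
    trans (sym (edges-cong (⨁ hs) h ⨁≈h)) (trans (edges-⨁ hs) (sym (total-≅ edges edges-≅ isos)))

  -- The orbit of the disjoint union is the leading one: a term with as many vertices comes from disjoint copies.
  leading-term : ∀ {cs ks} → Pointwise _≅_ cs ks → PairwiseDisjoint ks → ∀ h → HasTerm (product𝓞 cs) h →
    h ≅ ⨁ ks ⊎ nonIsolatedVertices h < nonIsolatedVertices (⨁ ks)
  leading-term {cs} {ks} isos disjs h term with hasTerm-product𝓞⁻ cs h term
  ... | hs , isos′ , ⨁≈h with disjoint-or-fewer-vertices hs
  ...   | inj₁ disjs′ = inj₁ (≅-trans (≅-sym (≈ᵍ⇒≅ ⨁≈h))
          (⨁-≅ disjs′ disjs (Pointwise.transitive ≅-trans (Pointwise.symmetric ≅-sym isos′) isos)))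
  ...   | inj₂ fewer = inj₂ (begin-strict
    nonIsolatedVertices h                   ≡⟨ nonIsolatedVertices-cong (⨁ hs) h ⨁≈h ⟨
    nonIsolatedVertices (⨁ hs)              <⟨ fewer ⟩
    total (map nonIsolatedVertices hs)      ≡⟨ total-≅ nonIsolatedVertices nonIsolatedVertices-≅ isos′ ⟨
    total (map nonIsolatedVertices cs)      ≡⟨ total-≅ nonIsolatedVertices nonIsolatedVertices-≅ isos ⟩
    total (map nonIsolatedVertices ks)      ≡⟨ nonIsolatedVertices-⨁ ks disjs ⟨
    nonIsolatedVertices (⨁ ks)              ∎)
    where open ≤-Reasoning

  -- Orbit sums from products, by triangularity

  module _ (char0 : CharacteristicZero K) where

    -- The only place where characteristic zero enters. Apartness from `0#` provides an inverse of
    -- the difference with `0#`, hence the correction by `x-0≈x`.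
    inverse : ∀ m → ∃[ v ] v *ᴷ (suc m · 1#) ≈ 1#
    inverse m = let v , v*[u-0]≈1 , _ = HeytingField.#⇒invertible K (char0 m) in
      v , ≈-trans (*-congˡ (≈-sym (x-0≈x (suc m · 1#)))) v*[u-0]≈1

    module _ {ℓ} {V : Pred Poly ℓ} (subspace : IsSubspace V) (d : ℕ) (products∈V : QuasiConnectedProduct d ⊆ V) where

      open IsSubspace subspace

      -- Induction on the number of non-isolated vertices. The product `P` over the components of
      -- `g` lies in `V` and differs from `u ·ₚ 𝓞 g` by orbits with fewer such vertices and the same
      -- number of edges; finally `u` is inverted.
      𝓞∈subspace : ∀ g → edges g ≡ d → V (𝓞 g)
      𝓞∈subspace g eg = go g eg (<-wellFounded _)
        where
        go : ∀ g → edges g ≡ d → Acc _<_ (nonIsolatedVertices g) → V (𝓞 g)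
        go g eg (acc rec) = V-resp (v ·ₚ (P +ₚ rest)) (𝓞 g) solve (V-· v (P +ₚ rest) (V-+ P rest P∈V rest∈V))
          where
          decomposition : ∃[ cs ] All QuasiConnected cs × PairwiseDisjoint cs × ⨁ cs ≈ᵍ g
          decomposition = decompose g
          cs : List (Multigraph n)
          cs = proj₁ decomposition
          disjs : PairwiseDisjoint cs
          disjs = proj₁ (proj₂ (proj₂ decomposition))
          ⨁≈g : ⨁ cs ≈ᵍ g
          ⨁≈g = proj₂ (proj₂ (proj₂ decomposition))
          isos : Pointwise _≅_ cs cs
          isos = Pointwise.refl ≅-refl
          P : Poly
          P = product𝓞 cs
          edges≡d : total (map edges cs) ≡ d
          edges≡d = trans (sym (edges-⨁ cs)) (trans (edges-cong (⨁ cs) g ⨁≈g) eg)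
          P∈V : V P
          P∈V = products∈V
            ( cs , proj₁ (proj₂ decomposition)
            -- The bound on the vertices is automatic: the components are disjoint inside a graph on
            -- `n` vertices.
            , subst (_≤ n) (nonIsolatedVertices-⨁ cs disjs) (nonIsolatedVertices≤n (⨁ cs))
            , edges≡d , λ h → ≈-refl )
          leading : ∃[ m ] coeff P (⨁ cs) ≈ suc m · 1#
          leading = coeff-term P (unitary-product𝓞 cs) (⨁ cs) (hasTerm-product𝓞⁺ isos)
          u : Carrier
          u = suc (proj₁ leading) · 1#
          v : Carrier
          v = proj₁ (inverse (proj₁ leading))
          rest : Poly
          -- `u` is the coefficient of `P` on the orbit of `g`, so that this orbit cancels in
          -- `rest`, while `P +ₚ rest` equals `u ·ₚ 𝓞 g`.
          rest = u ·ₚ 𝓞 g +ₚ (- 1#) ·ₚ P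
          coeff-rest : ∀ h → coeff rest h ≈ u *ᴷ [ g ≅? h ] +ᴷ - coeff P h
          coeff-rest h = ≈-trans (coeff-+ₚ (u ·ₚ 𝓞 g) ((- 1#) ·ₚ P) h) (+-cong
            (≈-trans (coeff-·ₚ u (𝓞 g) h) (*-congˡ (coeff-𝓞 g h)))
            (≈-trans (coeff-·ₚ (- 1#) P h) (-1*x≈-x _)))
          rest-orbits : ∀ h → coeff rest h ≈ 0# ⊎ V (𝓞 h)
          rest-orbits h with g ≅? h
          ... | yes g≅h = inj₁ (≈-trans (coeff-rest h) (≈-trans
                (+-cong (≈-trans (*-congˡ ([]-true (g ≅? h) g≅h)) (*-identityʳ u)) (-‿cong (≈-trans
                  (≈-sym (invariant⇒classFunction P (invariant-product𝓞 cs) (≅-trans (≈ᵍ⇒≅ ⨁≈g) g≅h)))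
                  (proj₂ leading))))
                (-‿inverseʳ u)))
          ... | no g≇h with hasTerm? P h
          ...   | no ¬term = inj₁ (≈-trans (coeff-rest h) (≈-trans
                  (+-cong (≈-trans (*-congˡ ([]-false (g ≅? h) g≇h)) (zeroʳ u))
                          (≈-trans (-‿cong (coeff-noTerm P h ¬term)) -0#≈0#))
                  (+ᴷ-identityˡ 0#)))
          ...   | yes term with leading-term isos disjs h term
          ...     | inj₁ h≅⨁   = contradiction (≅-sym (≅-trans h≅⨁ (≈ᵍ⇒≅ ⨁≈g))) g≇h
          ...     | inj₂ fewer = inj₂ (go h (trans (term-edges cs h term) edges≡d)
                    (rec (subst (nonIsolatedVertices h <_) (nonIsolatedVertices-cong (⨁ cs) g ⨁≈g) fewer)))
          rest∈V : V rest
          rest∈V = invariant∈subspace subspace rest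
            (invariant-+ₚ (u ·ₚ 𝓞 g) ((- 1#) ·ₚ P) (invariant-·ₚ u (𝓞 g) (invariant-𝓞 g))
              (invariant-·ₚ (- 1#) P (invariant-product𝓞 cs)))
            rest-orbits
          solve : v ·ₚ (P +ₚ rest) ≈ₚ 𝓞 g
          solve h = begin
            coeff (v ·ₚ (P +ₚ rest)) h                                   ≈⟨ coeff-·ₚ v (P +ₚ rest) h ⟩
            v *ᴷ coeff (P +ₚ rest) h                                     ≈⟨ *-congˡ (coeff-+ₚ P rest h) ⟩
            v *ᴷ (coeff P h +ᴷ coeff rest h)                             ≈⟨ *-congˡ (+-congˡ (coeff-rest h)) ⟩
            v *ᴷ (coeff P h +ᴷ (u *ᴷ [ g ≅? h ] +ᴷ - coeff P h))         ≈⟨ *-congˡ (x+[y-x]≈y (coeff P h) _) ⟩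
            v *ᴷ (u *ᴷ [ g ≅? h ])                                       ≈⟨ *ᴷ-assoc v u _ ⟨
            v *ᴷ u *ᴷ [ g ≅? h ]                                         ≈⟨ *-congʳ (proj₂ (inverse (proj₁ leading))) ⟩
            1# *ᴷ [ g ≅? h ]                                             ≈⟨ *-identityˡ _ ⟩
            [ g ≅? h ]                                                   ≈⟨ coeff-𝓞 g h ⟨
            coeff (𝓞 g) h                                                ∎
            where
            open SetoidReasoning K-setoid
            x+[y-x]≈y : ∀ x y → x +ᴷ (y +ᴷ - x) ≈ y
            x+[y-x]≈y x y = ≈-trans (+-congˡ (+ᴷ-comm y (- x))) (≈-trans (≈-sym (+ᴷ-assoc x (- x) y))
              (≈-trans (+-congʳ (-‿inverseʳ x)) (+ᴷ-identityˡ y)))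

  -- Linear combinations

  linearCombination-scale : ∀ {k} x (a : Fin k → Carrier) (b : Fin k → Poly) h →
    coeff (linearCombination (λ i → x *ᴷ a i) b) h ≈ x *ᴷ coeff (linearCombination a b) h
  linearCombination-scale {zero}  x a b h = ≈-sym (zeroʳ x)
  linearCombination-scale {suc k} x a b h = begin
    coeff ((x *ᴷ a zero) ·ₚ b zero +ₚ linearCombination (λ i → x *ᴷ a (suc i)) (b ∘ suc)) h
      ≈⟨ coeff-+ₚ ((x *ᴷ a zero) ·ₚ b zero) _ h ⟩
    coeff ((x *ᴷ a zero) ·ₚ b zero) h +ᴷ coeff (linearCombination (λ i → x *ᴷ a (suc i)) (b ∘ suc)) h
      ≈⟨ +-cong (≈-trans (coeff-·ₚ (x *ᴷ a zero) (b zero) h) (*ᴷ-assoc x (a zero) _))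
                (linearCombination-scale x (a ∘ suc) (b ∘ suc) h) ⟩
    x *ᴷ (a zero *ᴷ coeff (b zero) h) +ᴷ x *ᴷ coeff (linearCombination (a ∘ suc) (b ∘ suc)) h
      ≈⟨ distribˡ x _ _ ⟨
    x *ᴷ (a zero *ᴷ coeff (b zero) h +ᴷ coeff (linearCombination (a ∘ suc) (b ∘ suc)) h)
      ≈⟨ *-congˡ (+-congʳ (coeff-·ₚ (a zero) (b zero) h)) ⟨
    x *ᴷ (coeff (a zero ·ₚ b zero) h +ᴷ coeff (linearCombination (a ∘ suc) (b ∘ suc)) h)
      ≈⟨ *-congˡ (coeff-+ₚ (a zero ·ₚ b zero) _ h) ⟨
    x *ᴷ coeff (linearCombination a b) h ∎
    where open SetoidReasoning K-setoid

  linearCombination-zero : ∀ {k} (a : Fin k → Carrier) (b : Fin k → Poly) h →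
    (∀ j → a j *ᴷ coeff (b j) h ≈ 0#) → coeff (linearCombination a b) h ≈ 0#
  linearCombination-zero {zero}  a b h zeros = ≈-refl
  linearCombination-zero {suc k} a b h zeros = ≈-trans (coeff-+ₚ (a zero ·ₚ b zero) _ h) (≈-trans
    (+-cong (≈-trans (coeff-·ₚ (a zero) (b zero) h) (zeros zero))
            (linearCombination-zero (a ∘ suc) (b ∘ suc) h (zeros ∘ suc)))
    (+ᴷ-identityˡ 0#))

  linearCombination-single : ∀ {k} (a : Fin k → Carrier) (b : Fin k → Poly) h i →
    (∀ j → j ≢ i → a j *ᴷ coeff (b j) h ≈ 0#) → coeff (linearCombination a b) h ≈ a i *ᴷ coeff (b i) h
  linearCombination-single {suc k} a b h zero zeros = ≈-trans (coeff-+ₚ (a zero ·ₚ b zero) _ h) (≈-trans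
    (+-cong (coeff-·ₚ (a zero) (b zero) h)
            (linearCombination-zero (a ∘ suc) (b ∘ suc) h λ j → zeros (suc j) λ ()))
    (+ᴷ-identityʳ _))
  linearCombination-single {suc k} a b h (suc i) zeros = ≈-trans (coeff-+ₚ (a zero ·ₚ b zero) _ h) (≈-trans
    (+-cong (≈-trans (coeff-·ₚ (a zero) (b zero) h) (zeros zero λ ()))
            (linearCombination-single (a ∘ suc) (b ∘ suc) h i λ j j≢i → zeros (suc j) (j≢i ∘ suc-injective)))
    (+ᴷ-identityˡ _))

  module _ {ℓ} {B : Pred Poly ℓ} where

    span-isSubspace : IsSubspace (Span B)
    span-isSubspace = record
      { V-resp = λ p q p≈q (k , a , b , b∈B , p≈ab) → k , a , b , b∈B , λ h → ≈-trans (≈-sym (p≈q h)) (p≈ab h)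
      ; V-0    = 0 , (λ ()) , (λ ()) , (λ ()) , λ h → ≈-refl
      ; V-+    = λ p q (k , a , b , b∈B , p≈ab) q∈ → resp (linearCombination a b +ₚ q) (p +ₚ q)
          (λ h → ≈-trans (coeff-+ₚ (linearCombination a b) q h)
            (≈-trans (+-congʳ (≈-sym (p≈ab h))) (≈-sym (coeff-+ₚ p q h))))
          (extend q∈ k a b b∈B)
      ; V-·    = λ x p (k , a , b , b∈B , p≈ab) → k , (λ i → x *ᴷ a i) , b , b∈B , λ h →
          ≈-trans (coeff-·ₚ x p h) (≈-trans (*-congˡ (p≈ab h)) (≈-sym (linearCombination-scale x a b h)))
      }
      where
      resp : ∀ p q → p ≈ₚ q → Span B p → Span B q
      resp p q p≈q (k , a , b , b∈B , p≈ab) = k , a , b , b∈B , λ h → ≈-trans (≈-sym (p≈q h)) (p≈ab h)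
      extend : ∀ {q} → Span B q → ∀ k (a : Fin k → Carrier) (b : Fin k → Poly) → (∀ i → B (b i)) →
        Span B (linearCombination a b +ₚ q)
      extend q∈ zero    a b b∈B = q∈
      extend {q} q∈ (suc k) a b b∈B =
        let k′ , a′ , b′ , b′∈B , eq = extend q∈ k (a ∘ suc) (b ∘ suc) (b∈B ∘ suc)
        in suc k′ , a zero Vector.∷ a′ , b zero Vector.∷ b′ , (λ { zero → b∈B zero ; (suc i) → b′∈B i }) , λ h →
          ≈-trans (≈-reflexive (cong (λ p → coeff p h) (++-assoc (a zero ·ₚ b zero) _ q)))
            (≈-trans (coeff-+ₚ (a zero ·ₚ b zero) _ h)
              (≈-trans (+-congˡ (eq h)) (≈-sym (coeff-+ₚ (a zero ·ₚ b zero) (linearCombination a′ b′) h))))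

    ⊆span : ∀ {p} → B p → Span B p
    ⊆span {p} p∈B = 1 , (λ _ → 1#) , (λ _ → p) , (λ _ → p∈B) , λ h → ≈-sym (≈-trans
      (coeff-+ₚ (1# ·ₚ p) 0ₚ h) (≈-trans (+ᴷ-identityʳ _) (≈-trans (coeff-·ₚ 1# p h) (*-identityˡ _))))

  -- The basis

  product⇒homogeneousInvariant : ∀ d → QuasiConnectedProduct d ⊆ HomogeneousInvariant d
  product⇒homogeneousInvariant d {p} (cs , _ , _ , edges≡d , p≈) =
    invariant-resp (product𝓞 cs) p (λ h → ≈-sym (p≈ h)) (invariant-product𝓞 cs) ,
    λ h h≢d → ≈-trans (p≈ h) (coeff-noTerm (product𝓞 cs) h λ term → h≢d (trans (term-edges cs h term) edges≡d))

  module _ (char0 : CharacteristicZero K) where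

    homogeneousInvariant⇒span : ∀ d → HomogeneousInvariant d ⊆ Span (QuasiConnectedProduct d)
    homogeneousInvariant⇒span d {p} (inv , hom) = invariant∈subspace subspace p inv λ h →
      case edges h ≟ d of λ where
        (yes h≡d) → inj₂ (𝓞∈subspace char0 subspace d (λ {q} → ⊆span {B = QuasiConnectedProduct d} {p = q}) h h≡d)
        (no  h≢d) → inj₁ (hom h h≢d)
      where
      subspace : IsSubspace (Span (QuasiConnectedProduct d))
      subspace = span-isSubspace {B = QuasiConnectedProduct d}

    -- The relation is read at the leading graph `G i` of `b i`. Another `b j` can contribute there
    -- only if `G j` has more non-isolated vertices, and then its scalar is already known to vanish.
    products-independent : ∀ d → LinearlyIndependent (QuasiConnectedProduct d)
    products-independent d {k} a b b∈ b-injective sum≈0 i = go i (<-wellFounded _)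
      where
      cs : Fin k → List (Multigraph n)
      cs i = proj₁ (b∈ i)
      qcs : ∀ i → All QuasiConnected (cs i)
      qcs i = proj₁ (proj₂ (b∈ i))
      b≈ : ∀ i → b i ≈ₚ product𝓞 (cs i)
      b≈ i = proj₂ (proj₂ (proj₂ (proj₂ (b∈ i))))
      -- The bound on the total number of vertices provides the room for a disjoint union, which is
      -- the leading graph.
      copies : ∀ i → ∃[ ks ] Pointwise _≅_ (cs i) ks × PairwiseDisjoint ks
      copies i = disjoint-copies (cs i) (proj₁ (proj₂ (proj₂ (b∈ i))))
      ks : Fin k → List (Multigraph n)
      ks i = proj₁ (copies i)
      isos : ∀ i → Pointwise _≅_ (cs i) (ks i)
      isos i = proj₁ (proj₂ (copies i))
      disjs : ∀ i → PairwiseDisjoint (ks i)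
      disjs i = proj₂ (proj₂ (copies i))
      G : Fin k → Multigraph n
      G i = ⨁ (ks i)
      -- Members of the family are distinct as polynomials only, so isomorphic leading graphs must
      -- be shown to force equal products, whatever lists the products came from.
      G-injective : ∀ i j → G i ≅ G j → i ≡ j
      G-injective i j Gi≅Gj = b-injective i j λ h → begin
        coeff (b i) h                ≈⟨ b≈ i h ⟩
        coeff (product𝓞 (cs i)) h    ≈⟨ product𝓞-cong (isos i) h ⟩
        coeff (product𝓞 (ks i)) h    ≈⟨ product𝓞-unique (ks i) (ks j) (quasiConnected-all-≅ (isos i) (qcs i))
                                          (quasiConnected-all-≅ (isos j) (qcs j)) (disjs i) (disjs j) Gi≅Gj h ⟩
        coeff (product𝓞 (ks j)) h    ≈⟨ product𝓞-cong (isos j) h ⟨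
        coeff (product𝓞 (cs j)) h    ≈⟨ b≈ j h ⟨
        coeff (b j) h                ∎
        where open SetoidReasoning K-setoid
      -- The induction descends from the largest leading graphs, hence the complement to `n` as
      -- measure.
      go : ∀ i → Acc _<_ (n ∸ nonIsolatedVertices (G i)) → a i ≈ 0#
      go i (acc rec) = begin
        a i                                   ≈⟨ *-identityʳ _ ⟨
        a i *ᴷ 1#                             ≈⟨ *-congˡ (≈-trans (*-comm u v) (proj₂ (inverse char0 (proj₁ leading)))) ⟨
        a i *ᴷ (u *ᴷ v)                       ≈⟨ *ᴷ-assoc (a i) u v ⟨
        a i *ᴷ u *ᴷ v                         ≈⟨ *-congʳ (*-congˡ (≈-trans (b≈ i (G i)) (proj₂ leading))) ⟨
        a i *ᴷ coeff (b i) (G i) *ᴷ v         ≈⟨ *-congʳ (linearCombination-single a b (G i) i others) ⟨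
        coeff (linearCombination a b) (G i) *ᴷ v
                                              ≈⟨ *-congʳ (sum≈0 (G i)) ⟩
        0# *ᴷ v                               ≈⟨ zeroˡ v ⟩
        0#                                    ∎
        where
        open SetoidReasoning K-setoid
        leading : ∃[ m ] coeff (product𝓞 (cs i)) (G i) ≈ suc m · 1#
        leading = coeff-term (product𝓞 (cs i)) (unitary-product𝓞 (cs i)) (G i) (hasTerm-product𝓞⁺ (isos i))
        u : Carrier
        u = suc (proj₁ leading) · 1#
        v : Carrier
        v = proj₁ (inverse char0 (proj₁ leading))
        others : ∀ j → j ≢ i → a j *ᴷ coeff (b j) (G i) ≈ 0#
        others j j≢i with hasTerm? (product𝓞 (cs j)) (G i)
        ... | no ¬term = ≈-trans (*-congˡ (≈-trans (b≈ j (G i)) (coeff-noTerm (product𝓞 (cs j)) (G i) ¬term)))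
              (zeroʳ (a j))
        ... | yes term with leading-term (isos j) (disjs j) (G i) term
        ...   | inj₁ Gi≅Gj = contradiction (sym (G-injective i j Gi≅Gj)) j≢i
        ...   | inj₂ more  = ≈-trans
                (*-congʳ (go j (rec (∸-monoʳ-< more (nonIsolatedVertices≤n (G j)))))) (zeroˡ _)

    products-isBasis : ∀ d → IsBasis (HomogeneousInvariant d) (QuasiConnectedProduct d)
    products-isBasis d = record
      { contained   = λ {p} → product⇒homogeneousInvariant d {p}
      ; spanning    = λ {p} → homogeneousInvariant⇒span d {p}
      ; independent = products-independent d
      }

  -- Generators

  module _ {ℓ} {S : Pred Poly ℓ} where

    subalgebra-isSubspace : IsSubspace (Subalgebra S)
    subalgebra-isSubspace = record
      { V-resp = λ p q p≈q → respects p≈q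
      ; V-0    = respects {p = const 0#} {q = 0ₚ} const0≈0 (scalar 0#)
      ; V-+    = λ p q → plus
      ; V-·    = λ a p p∈ → respects {p = const a *ₚ p} {q = a ·ₚ p} (const*≈· a p) (times (scalar a) p∈)
      }
      where
      const0≈0 : const 0# ≈ₚ 0ₚ
      const0≈0 h = ≈-trans (+ᴷ-identityʳ _) (≈-trans (if-[] (∅ᵍ ≟ᵍ h) 0#) (zeroˡ _))
      const*≈· : ∀ a p → const a *ₚ p ≈ₚ a ·ₚ p
      const*≈· a p = ≈ₚ-intro (const a *ₚ p) (a ·ₚ p) λ {φ} φ-ext → ≈-trans (⟨⟩-*ₚ (const a) p φ)
        (≈-trans (+ᴷ-identityʳ _) (≈-trans (*-congˡ (⟨⟩-cong p λ g → φ-ext _ g λ i j → refl)) (≈-sym (⟨⟩-·ₚ a p φ))))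

    subalgebra⊆invariant : S ⊆ Invariant → Subalgebra S ⊆ Invariant
    subalgebra⊆invariant S⊆ {p} (generator p∈S) = S⊆ {p} p∈S
    subalgebra⊆invariant S⊆ (scalar a) = invariant-const a
    subalgebra⊆invariant S⊆ (plus {p} {q} p∈ q∈) =
      invariant-+ₚ p q (subalgebra⊆invariant S⊆ p∈) (subalgebra⊆invariant S⊆ q∈)
    subalgebra⊆invariant S⊆ (times {p} {q} p∈ q∈) =
      invariant-*ₚ p q (subalgebra⊆invariant S⊆ p∈) (subalgebra⊆invariant S⊆ q∈)
    subalgebra⊆invariant S⊆ (respects {p} {q} p≈q p∈) = invariant-resp p q p≈q (subalgebra⊆invariant S⊆ p∈)

    subalgebra-least : ∀ {ℓ′} {T : Pred Poly ℓ′} → T ⊆ Subalgebra S → Subalgebra T ⊆ Subalgebra S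
    subalgebra-least T⊆ (generator p∈T)    = T⊆ p∈T
    subalgebra-least T⊆ (scalar a)         = scalar a
    subalgebra-least T⊆ (plus p∈ q∈)       = plus (subalgebra-least T⊆ p∈) (subalgebra-least T⊆ q∈)
    subalgebra-least T⊆ (times p∈ q∈)      = times (subalgebra-least T⊆ p∈) (subalgebra-least T⊆ q∈)
    subalgebra-least T⊆ (respects p≈q p∈)  = respects p≈q (subalgebra-least T⊆ p∈)

  -- The numbers of edges of the factors add up to `d`, so each of them stays below `β`; the empty
  -- product is a scalar.
  product⇒subalgebra : ∀ {d β} → d ≤ β → QuasiConnectedProduct d ⊆ Subalgebra (QuasiConnectedOrbitSum β)
  product⇒subalgebra {d} {β} d≤β {p} (cs , qcs , _ , edges≡d , p≈) =
    respects {p = product𝓞 cs} {q = p} (λ h → ≈-sym (p≈ h))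
      (product∈ cs qcs (subst (_≤ β) (sym edges≡d) d≤β))
    where
    product∈ : ∀ cs → All QuasiConnected cs → total (map edges cs) ≤ β →
      Subalgebra (QuasiConnectedOrbitSum β) (product𝓞 cs)
    product∈ []       _          _     = scalar 1#
    product∈ (g ∷ cs) (qc ∷ qcs) bound = times {p = 𝓞 g} {q = product𝓞 cs}
      (generator (g , qc , m+n≤o⇒m≤o (edges g) bound , λ h → ≈-refl))
      (product∈ cs qcs (m+n≤o⇒n≤o (edges g) bound))

  orbitSums-generate : CharacteristicZero K → ∀ β → GeneratesInvariants (InvariantOfDegreeAtMost β) →
    GeneratesInvariants (QuasiConnectedOrbitSum β)
  orbitSums-generate char0 β (_ , generated) =
    (λ {p} → subalgebra⊆invariant (λ {p} (g , _ , _ , p≈) →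
      invariant-resp (𝓞 g) p (λ h → ≈-sym (p≈ h)) (invariant-𝓞 g))) ,
    (λ {p} inv → subalgebra-least (λ {q} → lowDegree∈ q) (generated {p} inv))
    where
    lowDegree∈ : ∀ p → InvariantOfDegreeAtMost β p → Subalgebra (QuasiConnectedOrbitSum β) p
    lowDegree∈ p (inv , deg) = invariant∈subspace subalgebra-isSubspace p inv λ h →
      case edges h ≤? β of λ where
        -- Each orbit sum is treated in its own degree `edges h`, so the homogeneous components of
        -- `p` are never formed.
        (yes h≤β) → inj₂ (𝓞∈subspace char0 subalgebra-isSubspace (edges h)
                      (λ {p} → product⇒subalgebra h≤β {p}) h refl)
        (no  h≰β) → inj₁ (deg h (≰⇒> h≰β))


proposition2p1 : ∀ {c ℓ₁ ℓ₂} (K : HeytingField c ℓ₁ ℓ₂) → CharacteristicZero K →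
    (n : ℕ) .{{_ : NonZero n}} →
    let open InvariantRing K n in
    (∀ d → IsBasis (HomogeneousInvariant d) (QuasiConnectedProduct d))
    × (∀ β → Isβ β → GeneratesInvariants (QuasiConnectedOrbitSum β))
proposition2p1 K char0 n =
  products-isBasis char0 , λ β (generates , _) → orbitSums-generate char0 β generates
  where open InvariantBasis K n
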